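{- There is a deterministic distributed algorithm in the CONGEST model that, for weighted TAP, computes a $2$-approximation (i.e., an augmentation $Aug$ with $T\cup Aug$ $2$-edge-connected and $w(Aug)\le 2\,w(OPT)$, where $OPT$ is a minimum-weight augmentation) and runs in $O(h)$ rounds, where $h$ is the height of the input tree $T$.
   Context: CONGEST model: the network is an undirected connected $n$-vertex graph $G=(V,E)$; computation proceeds in synchronous rounds, and in each round every vertex may send a message of $O(\log n)$ bits to each of its neighbours; complexity is the number of rounds. Weighted Tree Augmentation Problem (TAP): the input is a $2$-edge-connected graph $G$ (the network) with non-negative edge weights representable in $O(\log n)$ bits, and a spanning tree $T$ of $G$ rooted at a vertex $r$; each vertex knows which of its incident edges belong to $T$ and which one leads to its parent in $T$. The goal is to find a set $Aug$ of edges of $G$ of minimum total weight such that $T\cup Aug$ is $2$-edge-connected (remains connected after deleting any single edge). At the end each vertex must know which of its incident edges are in $Aug$. The height $h$ of $T$ is the maximum distance in $T$ from $r$ to a vertex. -}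

module Defs where

open import Data.Nat using (ℕ; zero; suc; _+_; _*_; _^_; _≤_; _<_; _⊔_; _<ᵇ_)
open import Data.Fin using (Fin; toℕ)
open import Data.Bool using (Bool; true; false; if_then_else_; _∧_; _∨_; not)
open import Data.Fin using (_≟_)
open import Relation.Nullary.Decidable using (⌊_⌋)
open import Data.Maybe using (Maybe; just; nothing)
open import Data.List using (List; []; _∷_; map; foldr; allFin; filter; cartesianProduct)
open import Data.Nat.ListAction using (sum)
open import Data.Product using (Σ; _×_; _,_; ∃)
open import Data.Sum using (_⊎_)
open import Relation.Nullary using (¬_)
open import Relation.Binary.PropositionalEquality using (_≡_; _≢_)
open import Function using (Injective)

Rel : ℕ → Set₁
Rel n = Fin n → Fin n → Set

data Reach {n : ℕ} (E : Rel n) : Fin n → Fin n → Set where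
  here : ∀ {u} → Reach E u u
  step : ∀ {u v x} → E u v → Reach E v x → Reach E u x

Connected : {n : ℕ} → Rel n → Set
Connected {n} E = (u v : Fin n) → Reach E u v

DeleteEdge : {n : ℕ} → Rel n → Fin n → Fin n → Rel n
DeleteEdge E a b u v = E u v × ¬ ((u ≡ a × v ≡ b) ⊎ (u ≡ b × v ≡ a))

TwoEdgeConnected : {n : ℕ} → Rel n → Set
TwoEdgeConnected {n} E =
  Connected E × ((a b : Fin n) → E a b → Connected (DeleteEdge E a b))

record Instance (n : ℕ) : Set where
  field
    adj        : Fin n → Fin n → Bool
    adj-sym    : ∀ u v → adj u v ≡ adj v u
    adj-irrefl : ∀ u → adj u u ≡ false
    G-2ec      : TwoEdgeConnected (λ u v → adj u v ≡ true)
    w          : Fin n → Fin n → ℕ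
    w-sym      : ∀ u v → w u v ≡ w v u
    ident      : Fin n → ℕ
    ident-inj  : Injective _≡_ _≡_ ident
    root       : Fin n
    par        : Fin n → Fin n
    par-root   : par root ≡ root
    par-adj    : ∀ v → v ≢ root → adj v (par v) ≡ true
    -- depth in T; its existence means following parents always reaches the root
    depth      : Fin n → ℕ
    depth-root : depth root ≡ 0
    depth-par  : ∀ v → v ≢ root → depth v ≡ suc (depth (par v))

module _ {n : ℕ} (I : Instance n) where
  open Instance I

  TreeEdge : Rel n
  TreeEdge u v = (u ≢ root × par u ≡ v) ⊎ (v ≢ root × par v ≡ u)

  isParent : Fin n → Fin n → Bool
  isParent v u = not ⌊ v ≟ root ⌋ ∧ ⌊ par v ≟ u ⌋

  isTreeEdge : Fin n → Fin n → Bool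
  isTreeEdge u v = isParent u v ∨ isParent v u

  height : ℕ
  height = foldr _⊔_ 0 (map depth (allFin n))

  Feasible : (Fin n → Fin n → Bool) → Set
  Feasible aug =
    (∀ u v → aug u v ≡ aug v u) ×
    (∀ u v → aug u v ≡ true → adj u v ≡ true) ×
    TwoEdgeConnected (λ u v → TreeEdge u v ⊎ aug u v ≡ true)

  -- total weight of Aug (each undirected edge counted once)
  cost : (Fin n → Fin n → Bool) → ℕ
  cost aug = sum (map (λ { (u , v) → if aug u v ∧ (toℕ u <ᵇ toℕ v) then w u v else 0 })
                      (cartesianProduct (allFin n) (allFin n)))

-- Local input of a vertex: (n , own identifier , incident edges), where each
-- incident edge is (identifier of the neighbour , weight , in T? , leads to parent?)
LocalInput : Set
LocalInput = ℕ × ℕ × List (ℕ × ℕ × Bool × Bool)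

-- A deterministic distributed algorithm: every vertex runs the same state machine.
-- In each round a vertex sends to each neighbour (addressed by its identifier)
-- either nothing or a message (a natural number), then updates its state from
-- the list of (sender identifier , received message) over all its neighbours.
-- output s = just f  means the vertex has (irrevocably) decided, f x telling whether
-- its incident edge to the neighbour with identifier x is in Aug.
record Algorithm : Set₁ where
  field
    State   : Set
    init    : LocalInput → State
    send    : State → ℕ → Maybe ℕ
    receive : State → List (ℕ × Maybe ℕ) → State
    output  : State → Maybe (ℕ → Bool)

module _ (A : Algorithm) {n : ℕ} (I : Instance n) where
  open Algorithm A
  open Instance I

  neighbours : Fin n → List (Fin n)
  neighbours v = filter (λ u → adj v u Data.Bool.≟ true) (allFin n)

  localInput : Fin n → LocalInput
  localInput v = n , ident v , map (λ u → ident u , w v u , isTreeEdge I v u , isParent I v u) (neighbours v)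

  stateAt : ℕ → Fin n → State
  stateAt zero    v = init (localInput v)
  stateAt (suc t) v = receive (stateAt t v) (map (λ u → ident u , send (stateAt t u) (ident v)) (neighbours v))

  -- A solves the instance within R rounds, with messages smaller than (n+2)^B
  -- (i.e. O(log n) bits), producing a 2-approximate augmentation
  SolvesWithin : (B R : ℕ) → Set
  SolvesWithin B R =
    (∀ t u v → adj u v ≡ true → ∀ m → send (stateAt t u) (ident v) ≡ just m → m < (n + 2) ^ B) ×
    Σ (Fin n → ℕ → Bool) λ ans →
      (∀ t v → (output (stateAt t v) ≡ nothing) ⊎ (output (stateAt t v) ≡ just (ans v))) ×
      (∀ v → output (stateAt R v) ≡ just (ans v)) ×
      (∀ u v → adj u v ≡ true → ans u (ident v) ≡ ans v (ident u)) ×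
      let aug = λ u v → adj u v ∧ ans u (ident v) in
      Feasible I aug × (∀ aug' → Feasible I aug' → cost I aug ≤ 2 * cost I aug')

-- weights and identifiers representable in O(log n) bits
WeightsBounded : ℕ → {n : ℕ} → Instance n → Set
WeightsBounded W {n} I = ∀ u v → Instance.w I u v < (n + 2) ^ W

IdentsBounded : ℕ → {n : ℕ} → Instance n → Set
IdentsBounded K {n} I = ∀ v → Instance.ident I v < (n + 2) ^ K

{-# OPTIONS --safe #-}
module Submission where

-- Orient every edge {u , v} of G both ways and let (u , v) cover the tree edges from u up to the lowest
-- common ancestor of u and v, at cost w u v. An augmentation of weight x yields a cover of weight at most
-- 2 x, and a cover yields an augmentation of at most the same weight, so an optimal cover is a
-- 2-approximation. Optimal covers obey a recursion on the tree: let C v a be the least cost of covering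
-- all tree edges below v together with the path from v up to depth a. Some single pair leaving the
-- subtree of v reaches depth a; it starts either at v, or below some child c, and then C c a pays for it,
-- while every other child c′ contributes C c′ (depth v).
--
-- If H is one plus the height of T, a vertex of depth d sends C v a in round 4 H − d − a, one round after
-- its children have sent their entries for a. From round 4 H on the choices are propagated from the root,
-- and after 6 H rounds every vertex knows those of its neighbours.

open import Defs
open import Data.Nat
open import Data.Nat.Properties
open import Data.Nat.DivMod using (_%_; _mod_; m<n⇒m%n≡m; m%n≤m; m%n<n)
open import Data.Nat.ListAction using (sum)
open import Data.Nat.ListAction.Properties using (sum-++)
open import Data.Fin as Fin using (Fin; zero; suc; toℕ; finToFun; funToFin)
import Data.Fin.Properties as Fin
open import Data.Bool as Bool using (Bool; true; false; if_then_else_; _∧_; _∨_; not; T)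
import Data.Bool.Properties as Bool
open import Data.Bool.ListAction using (and)
open import Data.Maybe using (Maybe; just; nothing)
open import Data.Maybe.Properties using (just-injective)
open import Data.List using (List; []; _∷_; map; foldr; allFin; filter; cartesianProduct; _++_)
open import Data.List.Properties using (map-∘; map-cong; map-cong-local; map-++; map-tabulate)
open import Data.List.Membership.Propositional using (_∈_)
open import Data.List.Membership.Propositional.Properties using (∈-allFin; ∈-filter⁺; ∈-filter⁻; ∈-map⁺; ∈-map⁻)
open import Data.List.Relation.Unary.Any using (here; there)
import Data.List.Relation.Unary.All as All
open import Data.Product using (Σ; _×_; _,_; proj₁; proj₂; ∃; ∃₂)
open import Data.Sum using (_⊎_; inj₁; inj₂; [_,_]′)
open import Data.Empty using (⊥; ⊥-elim)
open import Data.Unit using (tt)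
open import Relation.Nullary using (¬_; Dec; yes; no; contradiction)
open import Relation.Nullary.Decidable using (⌊_⌋; map′)
open import Relation.Binary.Definitions using (tri<; tri≈; tri>)
open import Relation.Binary.PropositionalEquality
open import Function using (_∘_; id)

-- Finite sums

-- The obstacle to linear time is the size of the table: row `v` has `depth v` entries, and passing
-- on complete rows level by level would take quadratically many rounds. But `C v a` refers only to
-- `C c a` and `C c (depth v)` with `a < depth v`, so rows can be streamed, larger `a` before
-- smaller, and the whole table fits between rounds 2 H and 4 H. The 2 H rounds before it are for
-- learning H, the depths and the ancestors; comparing ancestor identifiers lets a vertex decide
-- whether a neighbour lies outside the subtree of a given ancestor. Choices descend before round 5
-- H, when neighbours compare them. The other obstacle is message size: numbers are reduced modulo a
-- power of n + 2 before being sent. To avoid maintaining an ideal table next to the real one, `C`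
-- is defined as what is really sent, and optimality is derived from local relations between a
-- vertex and its children. That no reduction changes a value follows from bounds that survive
-- reduction, since it can only lower a number.

∑ : {A : Set} → List A → (A → ℕ) → ℕ
∑ xs f = sum (map f xs)

when : Bool → ℕ → ℕ
when b x = if b then x else 0

module _ {A : Set} where

  ∑-cong : {f g : A → ℕ} (xs : List A) → (∀ x → f x ≡ g x) → ∑ xs f ≡ ∑ xs g
  ∑-cong xs eq = cong sum (map-cong eq xs)

  ∑-mono : {f g : A → ℕ} (xs : List A) → (∀ x → f x ≤ g x) → ∑ xs f ≤ ∑ xs g
  ∑-mono []       le = z≤n
  ∑-mono (x ∷ xs) le = +-mono-≤ (le x) (∑-mono xs le)

  ∑-0 : (xs : List A) → ∑ xs (λ _ → 0) ≡ 0
  ∑-0 []       = refl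
  ∑-0 (x ∷ xs) = ∑-0 xs

  ∑-+ : (xs : List A) (f g : A → ℕ) → ∑ xs (λ x → f x + g x) ≡ ∑ xs f + ∑ xs g
  ∑-+ []       f g = refl
  ∑-+ (x ∷ xs) f g = begin
    f x + g x + ∑ xs (λ y → f y + g y)  ≡⟨ cong (f x + g x +_) (∑-+ xs f g) ⟩
    f x + g x + (∑ xs f + ∑ xs g)       ≡⟨ +-assoc (f x) (g x) _ ⟩
    f x + (g x + (∑ xs f + ∑ xs g))     ≡⟨ cong (f x +_) (sym (+-assoc (g x) _ _)) ⟩
    f x + (g x + ∑ xs f + ∑ xs g)       ≡⟨ cong (λ z → f x + (z + ∑ xs g)) (+-comm (g x) _) ⟩
    f x + (∑ xs f + g x + ∑ xs g)       ≡⟨ cong (f x +_) (+-assoc (∑ xs f) _ _) ⟩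
    f x + (∑ xs f + (g x + ∑ xs g))     ≡⟨ sym (+-assoc (f x) _ _) ⟩
    f x + ∑ xs f + (g x + ∑ xs g)       ∎
    where open ≡-Reasoning

  ∑-elem : {x : A} {xs : List A} (f : A → ℕ) → x ∈ xs → f x ≤ ∑ xs f
  ∑-elem {xs = y ∷ xs} f (here refl) = m≤m+n (f y) _
  ∑-elem {xs = y ∷ xs} f (there p)   = ≤-trans (∑-elem f p) (m≤n+m _ (f y))

  ∑-filter : (b : A → Bool) (f : A → ℕ) (xs : List A) →
    ∑ (filter (λ u → b u Bool.≟ true) xs) f ≡ ∑ xs (λ u → when (b u) (f u))
  ∑-filter b f []       = refl
  ∑-filter b f (x ∷ xs) with b x
  ... | true  = cong (f x +_) (∑-filter b f xs)
  ... | false = ∑-filter b f xs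

  ∑-when : (b : Bool) (xs : List A) (f : A → ℕ) → ∑ xs (λ x → when b (f x)) ≡ when b (∑ xs f)
  ∑-when true  xs f = refl
  ∑-when false xs f = ∑-0 xs

∑-swap : {A B : Set} (xs : List A) (ys : List B) (F : A → B → ℕ) →
  ∑ xs (λ x → ∑ ys (F x)) ≡ ∑ ys (λ y → ∑ xs (λ x → F x y))
∑-swap []       ys F = sym (∑-0 ys)
∑-swap (x ∷ xs) ys F =
  trans (cong (∑ ys (F x) +_) (∑-swap xs ys F)) (sym (∑-+ ys (F x) _))

∑-cartesianProduct : {A B : Set} (xs : List A) (ys : List B) (F : A × B → ℕ) →
  ∑ (cartesianProduct xs ys) F ≡ ∑ xs (λ x → ∑ ys (λ y → F (x , y)))
∑-cartesianProduct []       ys F = refl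
∑-cartesianProduct (x ∷ xs) ys F = begin
  sum (map F (map (x ,_) ys ++ cartesianProduct xs ys))
    ≡⟨ cong sum (map-++ F (map (x ,_) ys) _) ⟩
  sum (map F (map (x ,_) ys) ++ map F (cartesianProduct xs ys))
    ≡⟨ sum-++ (map F (map (x ,_) ys)) _ ⟩
  ∑ (map (x ,_) ys) F + ∑ (cartesianProduct xs ys) F
    ≡⟨ cong₂ _+_ (cong sum (sym (map-∘ ys))) (∑-cartesianProduct xs ys F) ⟩
  ∑ ys (λ y → F (x , y)) + ∑ xs (λ x → ∑ ys (λ y → F (x , y))) ∎
  where open ≡-Reasoning

∑-suc : ∀ {n} (f : Fin (suc n) → ℕ) → ∑ (allFin (suc n)) f ≡ f zero + ∑ (allFin n) (f ∘ suc)
∑-suc {n} f = cong (λ zs → f zero + sum zs)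
  (trans (map-tabulate suc f) (sym (map-tabulate id (f ∘ suc))))

∑-const : ∀ n c → ∑ (allFin n) (λ _ → c) ≡ n * c
∑-const zero    c = refl
∑-const (suc n) c = trans (∑-suc {n} (λ _ → c)) (cong (c +_) (∑-const n c))

≟-refl : ∀ {n} (x : Fin n) → ⌊ x Fin.≟ x ⌋ ≡ true
≟-refl x with x Fin.≟ x
... | yes _ = refl
... | no ¬p = contradiction refl ¬p

≟-comm : ∀ {n} (x y : Fin n) → ⌊ x Fin.≟ y ⌋ ≡ ⌊ y Fin.≟ x ⌋
≟-comm x y with x Fin.≟ y | y Fin.≟ x
... | yes _ | yes _ = refl
... | no  _ | no  _ = refl
... | yes p | no ¬q = contradiction (sym p) ¬q
... | no ¬p | yes q = contradiction (sym q) ¬p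

∑-delta : ∀ {n} (x : Fin n) (f : Fin n → ℕ) →
  ∑ (allFin n) (λ u → when ⌊ u Fin.≟ x ⌋ (f u)) ≡ f x
∑-delta {suc n} zero f = trans (∑-suc (λ u → when ⌊ u Fin.≟ zero ⌋ (f u))) (trans (cong (f zero +_) (∑-0 (allFin n))) (+-identityʳ _))
∑-delta {suc n} (suc x) f =
  trans (∑-suc (λ u → when ⌊ u Fin.≟ suc x ⌋ (f u))) (trans (∑-cong (allFin n) shift) (∑-delta x (f ∘ suc)))
  where
  shift : ∀ u → when ⌊ suc u Fin.≟ suc x ⌋ (f (suc u)) ≡ when ⌊ u Fin.≟ x ⌋ (f (suc u))
  shift u with u Fin.≟ x
  ... | yes _ = refl
  ... | no  _ = refl

∑-delta′ : ∀ {n} (x : Fin n) (f : Fin n → ℕ) →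
  ∑ (allFin n) (λ u → when ⌊ x Fin.≟ u ⌋ (f u)) ≡ f x
∑-delta′ {n} x f = trans (∑-cong (allFin n) (λ u → cong (λ b → when b (f u)) (≟-comm x u))) (∑-delta x f)

-- Booleans and conditional values

true≢false : {b : Bool} → b ≡ true → b ≡ false → ⊥
true≢false refl ()

¬true⇒false : {b : Bool} → (b ≡ true → ⊥) → b ≡ false
¬true⇒false {true}  f = ⊥-elim (f refl)
¬true⇒false {false} f = refl

T⇒true : {b : Bool} → T b → b ≡ true
T⇒true {true} _ = refl

true⇒T : {b : Bool} → b ≡ true → T b
true⇒T refl = tt

∧-true : {a b : Bool} → a ≡ true → b ≡ true → a ∧ b ≡ true
∧-true refl refl = refl

∧-true⁻ : {a b : Bool} → a ∧ b ≡ true → a ≡ true × b ≡ true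
∧-true⁻ {true} {true} _ = refl , refl

∨-true⁻ : {a b : Bool} → a ∨ b ≡ true → a ≡ true ⊎ b ≡ true
∨-true⁻ {true}          _ = inj₁ refl
∨-true⁻ {false} {true}  _ = inj₂ refl

∨-trueʳ : (a : Bool) {b : Bool} → b ≡ true → a ∨ b ≡ true
∨-trueʳ true  _    = refl
∨-trueʳ false refl = refl

∨-trueˡ : {a : Bool} (b : Bool) → a ≡ true → a ∨ b ≡ true
∨-trueˡ b refl = refl

when-≤ : (b : Bool) (x : ℕ) → when b x ≤ x
when-≤ true  x = ≤-refl
when-≤ false x = z≤n

when-true : {b : Bool} (x : ℕ) → b ≡ true → when b x ≡ x
when-true x refl = refl

∸-unsuc : ∀ {a d} → a < d → d ∸ a ≡ suc (d ∸ suc a)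
∸-unsuc {zero}  (s≤s _) = refl
∸-unsuc {suc a} (s≤s l) = ∸-unsuc l

when-cong : {b c : Bool} {x y : ℕ} → b ≡ c → (c ≡ true → x ≡ y) → when b x ≡ when c y
when-cong {true}  refl eq = eq refl
when-cong {false} refl eq = refl

when-∧ : ∀ a b x → when (a ∧ b) x ≡ when a (when b x)
when-∧ true  b x = refl
when-∧ false b x = refl

-- Trees, ancestors and two-edge-connectivity

foldr-⊔-elem : {x : ℕ} {xs : List ℕ} → x ∈ xs → x ≤ foldr _⊔_ 0 xs
foldr-⊔-elem {xs = y ∷ xs} (here refl) = m≤m⊔n y _
foldr-⊔-elem {xs = y ∷ xs} (there p)   = ≤-trans (foldr-⊔-elem p) (m≤n⊔m y _)

foldr-⊔-lub : {A : Set} {m : ℕ} (f : A → ℕ) (xs : List A) → (∀ x → x ∈ xs → f x ≤ m) → foldr _⊔_ 0 (map f xs) ≤ m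
foldr-⊔-lub f []       le = z≤n
foldr-⊔-lub f (x ∷ xs) le = ⊔-lub (le x (here refl)) (foldr-⊔-lub f xs (λ y p → le y (there p)))

module _ {n : ℕ} {E : Rel n} where

  reach-trans : ∀ {u v x} → Reach E u v → Reach E v x → Reach E u x
  reach-trans here       q = q
  reach-trans (step e p) q = step e (reach-trans p q)

  reach-sym : (∀ {u v} → E u v → E v u) → ∀ {u v} → Reach E u v → Reach E v u
  reach-sym E-sym here       = here
  reach-sym E-sym (step e p) = reach-trans (reach-sym E-sym p) (step (E-sym e) here)

module Tree {n : ℕ} (I : Instance n) where
  open Instance I

  V : List (Fin n)
  V = allFin n

  nbrs : Fin n → List (Fin n)
  nbrs v = filter (λ u → adj v u Bool.≟ true) V

  ∈-nbrs : ∀ {v u} → adj v u ≡ true → u ∈ nbrs v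
  ∈-nbrs {v} {u} = ∈-filter⁺ (λ u → adj v u Bool.≟ true) (∈-allFin u)

  nbrs-adj : ∀ {v u} → u ∈ nbrs v → adj v u ≡ true
  nbrs-adj {v} p = proj₂ (∈-filter⁻ (λ u → adj v u Bool.≟ true) {xs = V} p)

  child : Fin n → Fin n → Bool
  child = isParent I

  treeEdge : Fin n → Fin n → Bool
  treeEdge = isTreeEdge I

  child⁻ : ∀ c v → child c v ≡ true → c ≢ root × par c ≡ v
  child⁻ c v p with c Fin.≟ root | par c Fin.≟ v
  ... | no c≢r | yes e = c≢r , e

  child⁺ : ∀ c v → c ≢ root → par c ≡ v → child c v ≡ true
  child⁺ c v c≢r e with c Fin.≟ root | par c Fin.≟ v
  ... | no _  | yes _ = refl
  ... | yes p | _     = contradiction p c≢r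
  ... | no _  | no ¬q = contradiction e ¬q

  child-depth : ∀ {c v} → child c v ≡ true → depth c ≡ suc (depth v)
  child-depth {c} {v} p with child⁻ c v p
  ... | c≢r , refl = depth-par c c≢r

  child-asym : ∀ {c v} → child c v ≡ true → child v c ≡ false
  child-asym {c} {v} p = ¬true⇒false λ q → <-irrefl (trans (child-depth p) (cong suc (child-depth q))) (m≤n⇒m≤1+n ≤-refl)

  child-adj : ∀ {c v} → child c v ≡ true → adj v c ≡ true
  child-adj {c} {v} p with child⁻ c v p
  ... | c≢r , refl = trans (adj-sym _ _) (par-adj c c≢r)

  treeEdge⁻ : ∀ {u v} → treeEdge u v ≡ true → TreeEdge I u v
  treeEdge⁻ {u} {v} p with ∨-true⁻ {child u v} p
  ... | inj₁ q = inj₁ (child⁻ u v q)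
  ... | inj₂ q = inj₂ (child⁻ v u q)

  treeEdge⁺ : ∀ {u v} → TreeEdge I u v → treeEdge u v ≡ true
  treeEdge⁺ {u} {v} (inj₁ (a , b)) = ∨-trueˡ (child v u) (child⁺ u v a b)
  treeEdge⁺ {u} {v} (inj₂ (a , b)) = ∨-trueʳ (child u v) (child⁺ v u a b)

  treeEdge-sym : ∀ u v → treeEdge u v ≡ treeEdge v u
  treeEdge-sym u v = Bool.∨-comm (child u v) (child v u)

  -- As `par` fixes the root, iteration stops there, which matches the truncated subtraction of
  -- depths.
  up : ℕ → Fin n → Fin n
  up zero    v = v
  up (suc j) v = up j (par v)

  up-root : ∀ j → up j root ≡ root
  up-root zero    = refl
  up-root (suc j) = trans (cong (up j) par-root) (up-root j)

  up-+ : ∀ i j v → up (i + j) v ≡ up j (up i v)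
  up-+ zero    j v = refl
  up-+ (suc i) j v = up-+ i j (par v)

  par-up : ∀ j v → par (up j v) ≡ up (suc j) v
  par-up zero    v = refl
  par-up (suc j) v = par-up j (par v)

  depth>0 : ∀ {v} → v ≢ root → 0 < depth v
  depth>0 {v} v≢r rewrite depth-par v v≢r = s≤s z≤n

  depth-up : ∀ j v → depth (up j v) ≡ depth v ∸ j
  depth-up zero    v = refl
  depth-up (suc j) v with v Fin.≟ root
  ... | yes refl rewrite par-root | up-root j | depth-root = refl
  ... | no v≢r   rewrite depth-par v v≢r = depth-up j (par v)

  depth≤0⇒root : ∀ {v} → depth v ≤ 0 → v ≡ root
  depth≤0⇒root {v} le with v Fin.≟ root
  ... | yes p = p
  ... | no ¬p = contradiction (depth>0 ¬p) (≤⇒≯ le)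

  up-top : ∀ {j v} → depth v ≤ j → up j v ≡ root
  up-top {j} {v} le = depth≤0⇒root (≤-reflexive (trans (depth-up j v) (m≤n⇒m∸n≡0 le)))

  depth≤height : ∀ v → depth v ≤ height I
  depth≤height v = foldr-⊔-elem (∈-map⁺ depth (∈-allFin v))

  -- Pigeonhole: the iterated parents of `v` have pairwise different depths. This is what lets
  -- depths fit into messages.
  depth<n : ∀ v → depth v < n
  depth<n v = Fin.injective⇒≤ {f = λ (i : Fin (suc (depth v))) → up (toℕ i) v} inj
    where
    inj : ∀ {i j : Fin (suc (depth v))} → up (toℕ i) v ≡ up (toℕ j) v → i ≡ j
    inj {i} {j} eq = Fin.toℕ-injective (∸-cancelˡ-≡ (≤-pred (Fin.toℕ<n i)) (≤-pred (Fin.toℕ<n j))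
      (trans (sym (depth-up (toℕ i) v)) (trans (cong depth eq) (depth-up (toℕ j) v))))

  Anc : Fin n → Fin n → Set
  Anc z x = ∃ λ j → up j x ≡ z

  -- The depth of an ancestor determines it, so every witness can be normalised, an overshooting one
  -- meaning the root. Hence `Anc` is decidable.
  anc-level : ∀ {z x} → Anc z x → up (depth x ∸ depth z) x ≡ z
  anc-level {z} {x} (j , refl) with j ≤? depth x
  ... | yes j≤d = cong (λ k → up k x) (trans (cong (depth x ∸_) (depth-up j x)) (m∸[m∸n]≡n j≤d))
  ... | no  j≰d = trans (up-top (≤-reflexive (sym (cong (depth x ∸_) (trans (cong depth top) depth-root))))) (sym top)
    where
    top : up j x ≡ root
    top = up-top (<⇒≤ (≰⇒> j≰d))

  anc? : ∀ z x → Dec (Anc z x)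
  anc? z x = map′ (depth x ∸ depth z ,_) anc-level (up (depth x ∸ depth z) x Fin.≟ z)

  anc-trans : ∀ {y z x} → Anc y z → Anc z x → Anc y x
  anc-trans {x = x} (i , refl) (j , refl) = j + i , up-+ j i x

  anc-par : ∀ {z x} → Anc z (par x) → Anc z x
  anc-par (j , e) = suc j , e

  anc-parent : ∀ {z x} → Anc z x → x ≢ z → Anc z (par x)
  anc-parent (zero  , e) x≢z = contradiction e x≢z
  anc-parent (suc j , e) x≢z = j , e

  ¬anc-root : ∀ {z} → z ≢ root → ¬ Anc z root
  ¬anc-root z≢r (j , e) = z≢r (trans (sym e) (up-root j))

  anc-cases : ∀ {z x} → z ≢ root → Anc z x → x ≡ z ⊎ ∃ λ c → child c z ≡ true × Anc c x
  anc-cases         z≢r (zero  , e) = inj₁ e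
  anc-cases {z} {x} z≢r (suc j , e) = inj₂ (up j x , child⁺ (up j x) z c≢r (trans (par-up j x) e) , j , refl)
    where
    c≢r : up j x ≢ root
    c≢r p = z≢r (trans (sym e) (trans (sym (par-up j x)) (trans (cong par p) par-root)))

  -- Induction, recursion and summation along the tree

  leaf-induction : (P : Fin n → Set) → (∀ v → (∀ c → child c v ≡ true → P c) → P v) → ∀ v → P v
  leaf-induction P ih v = go (height I) v (m≤n+m _ (depth v))
    where
    go : ∀ k v → height I ≤ depth v + k → P v
    -- Without fuel `v` has maximal depth, and a child would exceed the height.
    go zero v le = ih v λ c p →
      contradiction (≤-trans (≤-reflexive (sym (child-depth p))) (depth≤height c))
                    (≤⇒≯ (≤-trans le (≤-reflexive (+-identityʳ _))))
    go (suc k) v le = ih v λ c p →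
      go k c (≤-trans le (≤-reflexive (trans (+-suc (depth v) k) (cong (_+ k) (sym (child-depth p))))))

  root-induction : (P : Fin n → Set) → P root → (∀ v → v ≢ root → P (par v) → P v) → ∀ v → P v
  root-induction P base ih v = go (depth v) v refl
    where
    go : ∀ d v → depth v ≡ d → P v
    go d v eq with v Fin.≟ root
    go d       v eq | yes refl = base
    go zero    v eq | no v≢r   = contradiction (trans (sym (depth-par v v≢r)) eq) (λ ())
    go (suc d) v eq | no v≢r   = ih v v≢r (go d (par v) (suc-injective (trans (sym (depth-par v v≢r)) eq)))

  -- Recursion over children by fuel: `suc (height I) ∸ depth v` drops by exactly one from a vertex
  -- to its child, so the recursion equation holds once `s v` reads its argument at children of `v`
  -- only.
  module Fold (s : Fin n → (Fin n → ℕ) → ℕ) where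

    iter : ℕ → Fin n → ℕ
    iter zero    v = 0
    iter (suc k) v = s v (iter k)

    fold : Fin n → ℕ
    fold v = iter (suc (height I) ∸ depth v) v

    fold-eq : (∀ v g h → (∀ c → child c v ≡ true → g c ≡ h c) → s v g ≡ s v h) → ∀ v → fold v ≡ s v fold
    fold-eq local v = trans (cong (λ k → iter k v) (+-∸-assoc 1 (depth≤height v)))
      (local v _ _ (λ c p → cong (λ d → iter (suc (height I) ∸ d) c) (sym (child-depth p))))

  ∑child : Fin n → (Fin n → ℕ) → ℕ
  ∑child v g = ∑ V (λ c → when (child c v) (g c))

  when-child : ∀ {v} {g h : Fin n → ℕ} → (∀ c → child c v ≡ true → g c ≡ h c) →
    ∀ c → when (child c v) (g c) ≡ when (child c v) (h c)
  when-child {v} eq c with child c v | eq c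
  ... | true  | e = e refl
  ... | false | _ = refl

  ∑child-cong : ∀ v {g h : Fin n → ℕ} → (∀ c → child c v ≡ true → g c ≡ h c) → ∑child v g ≡ ∑child v h
  ∑child-cong v eq = ∑-cong V (when-child eq)

  ∑child-mono : ∀ v {g h : Fin n → ℕ} → (∀ c → child c v ≡ true → g c ≤ h c) → ∑child v g ≤ ∑child v h
  ∑child-mono v {g} {h} le = ∑-mono V f≤
    where
    f≤ : ∀ c → when (child c v) (g c) ≤ when (child c v) (h c)
    f≤ c with child c v | le c
    ... | true  | l = l refl
    ... | false | _ = z≤n

  ∑nonroot : (Fin n → ℕ) → ℕ
  ∑nonroot g = ∑ V (λ c → when (not ⌊ c Fin.≟ root ⌋) (g c))

  ∑-root : ∀ g → ∑ V g ≡ g root + ∑nonroot g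
  ∑-root g = begin
    ∑ V g
      ≡⟨ ∑-cong V split ⟩
    ∑ V (λ c → when ⌊ c Fin.≟ root ⌋ (g c) + when (not ⌊ c Fin.≟ root ⌋) (g c))
      ≡⟨ ∑-+ V _ _ ⟩
    ∑ V (λ c → when ⌊ c Fin.≟ root ⌋ (g c)) + ∑nonroot g
      ≡⟨ cong (_+ ∑nonroot g) (∑-delta root g) ⟩
    g root + ∑nonroot g ∎
    where
    open ≡-Reasoning
    split : ∀ c → g c ≡ when ⌊ c Fin.≟ root ⌋ (g c) + when (not ⌊ c Fin.≟ root ⌋) (g c)
    split c with ⌊ c Fin.≟ root ⌋
    ... | true  = sym (+-identityʳ _)
    ... | false = refl

  -- Every vertex but the root is a child of exactly one vertex.
  ∑-∑child : ∀ g → ∑ V (λ v → ∑child v g) ≡ ∑nonroot g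
  ∑-∑child g = trans (∑-swap V V _) (∑-cong V inner)
    where
    inner : ∀ c → ∑ V (λ v → when (child c v) (g c)) ≡ when (not ⌊ c Fin.≟ root ⌋) (g c)
    inner c = trans (∑-cong V (λ v → when-∧ (not ⌊ c Fin.≟ root ⌋) ⌊ par c Fin.≟ v ⌋ (g c)))
      (trans (∑-when (not ⌊ c Fin.≟ root ⌋) V _)
             (cong (when (not ⌊ c Fin.≟ root ⌋)) (∑-delta′ (par c) (λ _ → g c))))

  -- If g v exceeds the sum of g over the children of v by f v, the sum of the f v telescopes.
  telescope : ∀ (g f : Fin n → ℕ) → (∀ v → g v ≡ f v + ∑child v g) → g root ≡ ∑ V f
  telescope g f eq = +-cancelʳ-≡ (∑nonroot g) _ _ (begin
    g root + ∑nonroot g                    ≡⟨ sym (∑-root g) ⟩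
    ∑ V g                                  ≡⟨ ∑-cong V eq ⟩
    ∑ V (λ v → f v + ∑child v g)           ≡⟨ ∑-+ V f _ ⟩
    ∑ V f + ∑ V (λ v → ∑child v g)         ≡⟨ cong (∑ V f +_) (∑-∑child g) ⟩
    ∑ V f + ∑nonroot g                     ∎)
    where open ≡-Reasoning

  -- `pot v` is the total of `f` over the subtree of `v`. It serves twice: with the weight of an
  -- augmentation for the lower bound, and with a constant to bound the size of messages.
  module Potential (f : Fin n → ℕ) where
    open Fold (λ v g → f v + ∑child v g) public using () renaming (fold to pot; fold-eq to pot-eq′)

    pot-eq : ∀ v → pot v ≡ f v + ∑child v pot
    pot-eq = pot-eq′ (λ v g h eq → cong (f v +_) (∑child-cong v eq))

    pot-root : pot root ≡ ∑ V f
    pot-root = telescope pot f pot-eq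

    pot-child : ∀ {c v} → child c v ≡ true → pot c ≤ pot v
    pot-child {c} {v} p = begin
      pot c                    ≡⟨ when-true (pot c) p ⟨
      when (child c v) (pot c) ≤⟨ ∑-elem (λ c → when (child c v) (pot c)) (∈-allFin c) ⟩
      ∑child v pot             ≤⟨ m≤n+m _ (f v) ⟩
      f v + ∑child v pot       ≡⟨ pot-eq v ⟨
      pot v                    ∎
      where open ≤-Reasoning

    pot≤ : ∀ v → pot v ≤ ∑ V f
    pot≤ v = ≤-trans (root-induction (λ v → pot v ≤ pot root) ≤-refl
      (λ v v≢r le → ≤-trans (pot-child (child⁺ v (par v) v≢r refl)) le) v) (≤-reflexive pot-root)

  -- Two-edge-connectivity as a condition on fundamental cuts

  tree-sym : ∀ {u v} → TreeEdge I u v → TreeEdge I v u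
  tree-sym (inj₁ p) = inj₂ p
  tree-sym (inj₂ p) = inj₁ p

  tree-leaves : ∀ {z x y} → TreeEdge I x y → Anc z x → ¬ Anc z y → x ≡ z × y ≡ par z × z ≢ root
  tree-leaves {z} {x} (inj₁ (x≢r , refl)) a ¬b with x Fin.≟ z
  ... | yes refl = refl , refl , x≢r
  ... | no  x≢z  = contradiction (anc-parent a x≢z) ¬b
  tree-leaves (inj₂ (_ , refl)) a ¬b = contradiction (anc-par a) ¬b

  -- The cut here is the one obtained by removing from T the edge between `z` and its parent.
  Crossing : (Fin n → Fin n → Bool) → Fin n → Set
  Crossing aug z = ∃₂ λ x y → Anc z x × ¬ Anc z y × aug x y ≡ true × treeEdge x y ≡ false

  leaving-edge : ∀ {E : Rel n} {z x y} → Reach E x y → Anc z x → ¬ Anc z y →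
    ∃₂ λ a b → E a b × Anc z a × ¬ Anc z b
  leaving-edge here a ¬b = contradiction a ¬b
  leaving-edge {z = z} (step {v = v} e p) a ¬b with anc? z v
  ... | yes q = leaving-edge p q ¬b
  ... | no ¬q = _ , v , e , a , ¬q

  -- After deleting the edge from `z` to its parent, a path from `z` to the root still leaves the
  -- subtree. The edge on which it does so is not in T, because the deleted edge was the only tree
  -- edge leaving.
  2ec⇒leaving : ∀ {E : Rel n} → TwoEdgeConnected E → (∀ z → z ≢ root → E z (par z)) → ∀ z → z ≢ root →
    ∃₂ λ x y → Anc z x × ¬ Anc z y × E x y × ¬ TreeEdge I x y
  2ec⇒leaving (_ , 2ec) tree⊆E z z≢r
    with leaving-edge (2ec z (par z) (tree⊆E z z≢r) z root) (0 , refl) (¬anc-root z≢r)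
  ... | x , y , (e , ¬del) , a , ¬b = x , y , a , ¬b , e , nontree
    where
    nontree : ¬ TreeEdge I x y
    nontree t with tree-leaves t a ¬b
    ... | refl , refl , _ = ¬del (inj₁ (refl , refl))

  feasible⇒crossing : ∀ {aug} → Feasible I aug → ∀ z → z ≢ root → Crossing aug z
  feasible⇒crossing (_ , _ , 2ec) z z≢r with 2ec⇒leaving 2ec (λ z z≢r → inj₁ (inj₁ (z≢r , refl))) z z≢r
  ... | x , y , a , ¬b , inj₁ t , nt = contradiction t nt
  ... | x , y , a , ¬b , inj₂ p , nt = x , y , a , ¬b , p , ¬true⇒false (λ t → nt (treeEdge⁻ t))

  -- The whole of G is one cover, so its weight bounds the optimum; this will exclude payments of
  -- `BIG`.
  adj-crossing : ∀ z → z ≢ root → Crossing adj z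
  adj-crossing z z≢r with 2ec⇒leaving G-2ec par-adj z z≢r
  ... | x , y , a , ¬b , p , nt = x , y , a , ¬b , p , ¬true⇒false (λ t → nt (treeEdge⁻ t))

  module _ (aug : Fin n → Fin n → Bool)
           (aug-sym : ∀ u v → aug u v ≡ aug v u)
           (crossing : ∀ z → z ≢ root → Crossing aug z) where

    private
      E : Rel n
      E u v = TreeEdge I u v ⊎ aug u v ≡ true

      E-sym : ∀ {u v} → E u v → E v u
      E-sym (inj₁ t) = inj₁ (tree-sym t)
      E-sym (inj₂ p) = inj₂ (trans (aug-sym _ _) p)

      Del-sym : ∀ a b {u v} → DeleteEdge E a b u v → DeleteEdge E a b v u
      Del-sym a b (e , ¬d) = E-sym e , λ { (inj₁ (p , q)) → ¬d (inj₂ (q , p)) ; (inj₂ (p , q)) → ¬d (inj₁ (q , p)) }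

      via-root : ∀ {F : Rel n} → (∀ {u v} → F u v → F v u) → (∀ v → Reach F v root) → Connected F
      via-root F-sym p u v = reach-trans (p u) (reach-sym F-sym (p v))

      to-root : ∀ v → Reach E v root
      to-root = root-induction (λ v → Reach E v root) here (λ v v≢r p → step (inj₁ (inj₁ (v≢r , refl))) p)

      -- Without the edge between `z` and its parent, the subtree of `z` still hangs together at `z`
      -- and the rest at the root; the crossing edge joins the two. `ab` admits both orientations of
      -- the deleted pair, and `onlyz` says that no other parent edge is lost.
      module Cut (a b z : Fin n) (z≢r : z ≢ root)
                 (onlyz : ∀ x → x ≢ root → x ≢ z → ¬ ((x ≡ a × par x ≡ b) ⊎ (x ≡ b × par x ≡ a)))
                 (ab : (a ≡ z × b ≡ par z) ⊎ (a ≡ par z × b ≡ z)) where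

        outside : ∀ v → ¬ Anc z v → Reach (DeleteEdge E a b) v root
        outside = root-induction (λ v → ¬ Anc z v → Reach (DeleteEdge E a b) v root) (λ _ → here) λ v v≢r ih ¬anc →
          step (inj₁ (inj₁ (v≢r , refl)) , onlyz v v≢r (λ { refl → ¬anc (0 , refl) })) (ih (λ q → ¬anc (anc-par q)))

        inside : ∀ j v → up j v ≡ z → Reach (DeleteEdge E a b) v z
        inside zero    v refl = here
        inside (suc j) v e with v Fin.≟ z
        ... | yes refl = here
        ... | no v≢z   = step (inj₁ (inj₁ (v≢r , refl)) , onlyz v v≢r v≢z) (inside j (par v) e)
          where
          v≢r : v ≢ root
          v≢r refl = z≢r (trans (sym e) (up-root (suc j)))

        bridge : Reach (DeleteEdge E a b) z root
        bridge with crossing z z≢r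
        ... | x , y , (j , e) , ¬anc , augxy , nt =
          reach-trans (reach-sym (Del-sym a b) (inside j x e)) (step (inj₂ augxy , kept ab) (outside y ¬anc))
          where
          absurd : TreeEdge I x y → ⊥
          absurd t = true≢false (treeEdge⁺ t) nt
          kept : (a ≡ z × b ≡ par z) ⊎ (a ≡ par z × b ≡ z) → ¬ ((x ≡ a × y ≡ b) ⊎ (x ≡ b × y ≡ a))
          kept (inj₁ (refl , refl)) (inj₁ (refl , refl)) = absurd (inj₁ (z≢r , refl))
          kept (inj₁ (refl , refl)) (inj₂ (refl , refl)) = absurd (inj₂ (z≢r , refl))
          kept (inj₂ (refl , refl)) (inj₁ (refl , refl)) = absurd (inj₂ (z≢r , refl))
          kept (inj₂ (refl , refl)) (inj₂ (refl , refl)) = absurd (inj₁ (z≢r , refl))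

        connected : Connected (DeleteEdge E a b)
        connected = via-root {DeleteEdge E a b} (Del-sym a b) case
          where
          case : ∀ v → Reach (DeleteEdge E a b) v root
          case v with anc? z v
          ... | no ¬q       = outside v ¬q
          ... | yes (j , e) = reach-trans (inside j v e) bridge

      no-two-cycle : ∀ {x z} → x ≢ root → z ≢ root → par x ≡ z → par z ≡ x → ⊥
      no-two-cycle {x} {z} x≢r z≢r p q = true≢false (child⁺ z x z≢r q) (child-asym (child⁺ x z x≢r p))

    crossing⇒2ec : TwoEdgeConnected (λ u v → TreeEdge I u v ⊎ aug u v ≡ true)
    crossing⇒2ec = via-root {E} E-sym to-root , λ a b _ → del a b
      where
      del : ∀ a b → Connected (DeleteEdge E a b)
      del a b with treeEdge a b in eq
      -- The deleted pair is not in T, so all paths to the root along T survive.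
      ... | false = via-root {DeleteEdge E a b} (Del-sym a b) (root-induction (λ v → Reach (DeleteEdge E a b) v root) here (λ v v≢r p →
                step (inj₁ (inj₁ (v≢r , refl)) ,
                  λ { (inj₁ (refl , refl)) → true≢false (treeEdge⁺ (inj₁ (v≢r , refl))) eq
                    ; (inj₂ (refl , refl)) → true≢false (treeEdge⁺ (inj₂ (v≢r , refl))) eq }) p))
      ... | true with treeEdge⁻ {a} {b} eq
      ... | inj₁ (a≢r , refl) = Cut.connected a (par a) a a≢r
              (λ { x x≢r x≢z (inj₁ (p , _)) → x≢z p ; x x≢r x≢z (inj₂ (p , q)) → no-two-cycle x≢r a≢r q (sym p) })
              (inj₁ (refl , refl))
      ... | inj₂ (b≢r , refl) = Cut.connected (par b) b b b≢r
              (λ { x x≢r x≢z (inj₁ (p , q)) → no-two-cycle x≢r b≢r q (sym p) ; x x≢r x≢z (inj₂ (p , _)) → x≢z p })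
              (inj₂ (refl , refl))

-- Covering by a table of optimal costs

module Approximation {n : ℕ} (I : Instance n) where
  open Instance I
  open Tree I

  -- Ordered pairs are counted, so a symmetric set pays for each edge once per endpoint. This is
  -- where the factor 2 is lost.
  directed : (Fin n → Fin n → Bool) → ℕ
  directed aug = ∑ V (λ x → ∑ V (λ y → when (aug x y) (w x y)))

  -- For `a < depth v`, `up (depth v ∸ suc a) v` is the ancestor of `v` at depth `suc a`. Being
  -- outside its subtree means that the common ancestor has depth at most `a`, and this condition
  -- reads the same from a child.
  up-child : ∀ {c v a} → child c v ≡ true → a < depth v →
    up (depth c ∸ suc a) c ≡ up (depth v ∸ suc a) v
  up-child {c} {v} {a} p a<d with child⁻ c v p
  ... | c≢r , refl = cong (λ k → up k c) (trans (cong (_∸ suc a) (child-depth p)) (∸-unsuc a<d))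

  up-self : ∀ {c v} → child c v ≡ true → up (depth c ∸ suc (depth v)) c ≡ c
  up-self {c} {v} p = cong (λ k → up k c) (trans (cong (_∸ suc (depth v)) (child-depth p)) (n∸n≡0 (depth v)))

  child≢root : ∀ {c v} → child c v ≡ true → c ≢ root
  child≢root {c} {v} p = proj₁ (child⁻ c v p)

  -- Only local properties of `C` are assumed in what follows, so that it can be instantiated by the
  -- numbers that vertices actually send.
  module Table
    (BIG : ℕ)
    (C : Fin n → ℕ → ℕ)
    (cov : Fin n → ℕ → Fin n → Bool)
    (cov⁺ : ∀ v a u → v ≢ root → a < depth v → ¬ Anc (up (depth v ∸ suc a) v) u → cov v a u ≡ true)
    (cov⁻ : ∀ v a u → v ≢ root → a < depth v → cov v a u ≡ true → ¬ Anc (up (depth v ∸ suc a) v) u)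
    where

    -- BIG exceeds any cost that is actually paid, so it rules out neighbours that do not cover up to depth a.
    own : Fin n → ℕ → Fin n → ℕ
    own v a u = if treeEdge v u then (if child u v then 0 else BIG)
                else (if cov v a u then w v u else BIG)

    -- One formula for both kinds of option: if `u` is no child of `v`, the test fails for all
    -- children and each covers only its own parent edge.
    value : Fin n → ℕ → Fin n → ℕ
    value v a u = own v a u + ∑child v (λ c → if ⌊ c Fin.≟ u ⌋ then C c a else C c (depth v))

    own-child : ∀ {v a u} → child u v ≡ true → own v a u ≡ 0
    own-child {v} {a} {u} p = pick (treeEdge⁺ {v} {u} (inj₂ (child⁻ u v p))) p
      where
      pick : ∀ {t c : Bool} {x y : ℕ} → t ≡ true → c ≡ true → (if t then (if c then 0 else x) else y) ≡ 0
      pick refl refl = refl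

    own-covers : ∀ {v a u} → treeEdge v u ≡ false → cov v a u ≡ true → own v a u ≡ w v u
    own-covers p q = pick p q
      where
      pick : ∀ {t c : Bool} {x y z : ℕ} → t ≡ false → c ≡ true → (if t then z else (if c then x else y)) ≡ x
      pick refl refl = refl

    own-small : ∀ {v a u} → own v a u < BIG →
      (treeEdge v u ≡ true × child u v ≡ true) ⊎ (treeEdge v u ≡ false × cov v a u ≡ true)
    own-small {v} {a} {u} = pick (treeEdge v u) (child u v) (cov v a u)
      where
      pick : ∀ t c k {x} → (if t then (if c then 0 else BIG) else (if k then x else BIG)) < BIG →
        (t ≡ true × c ≡ true) ⊎ (t ≡ false × k ≡ true)
      pick true  true  _     lt = inj₁ (refl , refl)
      pick true  false _     lt = contradiction lt (<-irrefl refl)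
      pick false _     true  lt = inj₂ (refl , refl)
      pick false _     false lt = contradiction lt (<-irrefl refl)

    -- Lower bound: the table against an arbitrary augmentation

    module LowerBound
      (C-opt : ∀ v a u → v ≢ root → a < depth v → adj v u ≡ true → C v a ≤ value v a u)
      (aug : Fin n → Fin n → Bool)
      (aug⊆adj : ∀ u v → aug u v ≡ true → adj u v ≡ true)
      (crossing : ∀ z → z ≢ root → Crossing aug z)
      where

      open Potential (λ x → ∑ V (λ y → when (aug x y) (w x y)))

      -- An oriented edge of `aug` starting in the subtree of `v` covers the path from `v` up to
      -- depth `a`.
      Escape : Fin n → ℕ → Set
      Escape v a = ∃₂ λ x y → Anc v x × ¬ Anc (up (depth v ∸ suc a) v) y × aug x y ≡ true × treeEdge x y ≡ false

      escape-self : ∀ {c v} → child c v ≡ true → Escape c (depth v)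
      escape-self {c} p with crossing c (child≢root p)
      ... | x , y , a , ¬b , rest = x , y , a , subst (λ z → ¬ Anc z y) (sym (up-self p)) ¬b , rest

      -- The edge witnessing the escape tells which option to compare with: its far end if it starts
      -- at `v`, otherwise the child above its start. For the remaining children an escape comes
      -- from their own cut. Subtrees of siblings are disjoint, so the weights add up to at most
      -- `pot v`.
      C≤pot : ∀ v → v ≢ root → ∀ a → a < depth v → Escape v a → C v a ≤ pot v
      C≤pot = leaf-induction _ λ v ih v≢r a a<d esc →
        ≤-trans (choose v ih v≢r a a<d esc) (≤-reflexive (sym (pot-eq v)))
        where
        choose : ∀ v → (∀ c → child c v ≡ true → c ≢ root → ∀ a → a < depth c → Escape c a → C c a ≤ pot c) →
          v ≢ root → ∀ a → a < depth v → Escape v a →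
          C v a ≤ ∑ V (λ y → when (aug v y) (w v y)) + ∑child v pot
        choose v ih v≢r a a<d (x , y , ax , ¬ay , augxy , nt) = [ here-case , below-case ]′ (anc-cases v≢r ax)
          where
          rest : ∀ c → child c v ≡ true → C c (depth v) ≤ pot c
          rest c p = ih c p (child≢root p) (depth v) (≤-reflexive (sym (child-depth p))) (escape-self p)
          here-case : x ≡ v → _
          here-case refl = ≤-trans (C-opt v a y v≢r a<d (aug⊆adj v y augxy)) (+-mono-≤
            (≤-trans (≤-reflexive (trans (own-covers nt (cov⁺ v a y v≢r a<d ¬ay)) (sym (when-true (w v y) augxy))))
                     (∑-elem (λ y → when (aug v y) (w v y)) (∈-allFin y)))
            (∑child-mono v others))
            where
            others : ∀ c → child c v ≡ true → (if ⌊ c Fin.≟ y ⌋ then C c a else C c (depth v)) ≤ pot c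
            others c p with c Fin.≟ y
            ... | yes refl = ⊥-elim (true≢false (treeEdge⁺ {v} {c} (inj₂ (child⁻ c v p))) nt)
            ... | no _     = rest c p
          below-case : (∃ λ c → child c v ≡ true × Anc c x) → _
          below-case (c , p , cx) = ≤-trans (C-opt v a c v≢r a<d (child-adj p)) (+-mono-≤
            (≤-trans (≤-reflexive (own-child p)) z≤n)
            (∑child-mono v others))
            where
            others : ∀ c′ → child c′ v ≡ true → (if ⌊ c′ Fin.≟ c ⌋ then C c′ a else C c′ (depth v)) ≤ pot c′
            others c′ q with c′ Fin.≟ c
            ... | yes refl = ih c p (child≢root p) a
                    (≤-trans a<d (≤-trans (n≤1+n _) (≤-reflexive (sym (child-depth p)))))
                    (x , y , cx , subst (λ z → ¬ Anc z y) (sym (up-child p a<d)) ¬ay , augxy , nt)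
            ... | no _     = rest c′ q

      ∑C≤directed : ∑child root (λ c → C c 0) ≤ directed aug
      ∑C≤directed = begin
        ∑child root (λ c → C c 0)  ≤⟨ ∑child-mono root top ⟩
        -- Edges oriented away from the root cover nothing; their weight is dropped.
        ∑child root pot            ≤⟨ m≤n+m _ _ ⟩
        _ + ∑child root pot        ≡⟨ pot-eq root ⟨
        pot root                   ≡⟨ pot-root ⟩
        directed aug               ∎
        where
        open ≤-Reasoning
        top : ∀ c → child c root ≡ true → C c 0 ≤ pot c
        top c p = C≤pot c (child≢root p) 0 (depth>0 (child≢root p))
          (subst (Escape c) depth-root (escape-self p))

    -- Upper bound: turning choices into an augmentation

    module UpperBound
      (C-opt : ∀ v a u → v ≢ root → a < depth v → adj v u ≡ true → C v a ≤ value v a u)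
      (adj<BIG : directed adj < BIG)
      (ch : Fin n → Fin n)
      (tg : Fin n → ℕ)
      (ch-root : ch root ≡ root)
      (ch-adj : ∀ v → v ≢ root → adj v (ch v) ≡ true)
      (tg< : ∀ v → v ≢ root → tg v < depth v)
      (tg-eq : ∀ c → c ≢ root → tg c ≡ (if ⌊ c Fin.≟ ch (par c) ⌋ then tg (par c) else depth (par c)))
      (C-ch : ∀ v → v ≢ root → C v (tg v) ≡ value v (tg v) (ch v))
      where

      spent : Fin n → ℕ
      spent v = when (not ⌊ v Fin.≟ root ⌋) (own v (tg v) (ch v))

      spent≡own : ∀ {v} → v ≢ root → spent v ≡ own v (tg v) (ch v)
      spent≡own {v} v≢r with v Fin.≟ root
      ... | yes p = contradiction p v≢r
      ... | no _  = refl

      spent-root : spent root ≡ 0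
      spent-root = cong (λ b → when (not b) (own root (tg root) (ch root))) (≟-refl root)

      -- By `tg-eq`, the child entries occurring in the chosen option are those at the children's
      -- own targets, so `C-ch` is a telescoping equation.
      ∑spent : ∑ V spent ≡ ∑child root (λ c → C c 0)
      ∑spent = trans (sym (telescope g spent g-eq)) g-root
        where
        g : Fin n → ℕ
        -- The root has no path to cover, so the sum over its children stands in for a table entry.
        g v = if ⌊ v Fin.≟ root ⌋ then ∑child root (λ c → C c (tg c)) else C v (tg v)
        g-nonroot : ∀ c → c ≢ root → g c ≡ C c (tg c)
        g-nonroot c c≢r with c Fin.≟ root
        ... | yes e = contradiction e c≢r
        ... | no _  = refl
        g-top : g root ≡ ∑child root (λ c → C c (tg c))
        g-top = cong (λ b → if b then ∑child root (λ c → C c (tg c)) else C root (tg root)) (≟-refl root)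
        g-child : ∀ v c → child c v ≡ true → g c ≡ C c (tg c)
        g-child v c p = g-nonroot c (child≢root p)
        g-eq : ∀ v → g v ≡ spent v + ∑child v g
        level : ∀ v → Dec (v ≡ root) → g v ≡ spent v + ∑child v g
        g-eq v = level v (v Fin.≟ root)
        level v (yes refl) = trans g-top (trans (∑child-cong root (λ c p → sym (g-child root c p)))
                                                (cong (_+ ∑child root g) (sym spent-root)))
        level v (no v≢r) = trans (g-nonroot v v≢r) (trans (C-ch v v≢r)
          (cong₂ _+_ (sym (spent≡own v≢r)) (∑child-cong v kids)))
          where
          kids : ∀ c → child c v ≡ true → (if ⌊ c Fin.≟ ch v ⌋ then C c (tg v) else C c (depth v)) ≡ g c
          kids c p with child⁻ c v p
          ... | c≢r , refl = trans (sym (trans (cong (C c) (tg-eq c c≢r)) push)) (sym (g-child v c p))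
            where
            push : C c (if ⌊ c Fin.≟ ch v ⌋ then tg v else depth v) ≡ (if ⌊ c Fin.≟ ch v ⌋ then C c (tg v) else C c (depth v))
            push with ⌊ c Fin.≟ ch v ⌋
            ... | true  = refl
            ... | false = refl
        g-root : g root ≡ ∑child root (λ c → C c 0)
        g-root = trans g-top (∑child-cong root λ c p → cong (C c) (tg0 c p))
          where
          tg0 : ∀ c → child c root ≡ true → tg c ≡ 0
          tg0 c p = n<1⇒n≡0 (≤-trans (tg< c (child≢root p)) (≤-reflexive (trans (child-depth p) (cong suc depth-root))))

      spent≤ : ∀ aug → (∀ u v → aug u v ≡ true → adj u v ≡ true) → (∀ z → z ≢ root → Crossing aug z) →
        ∑ V spent ≤ directed aug
      spent≤ aug sub cr = ≤-trans (≤-reflexive ∑spent) (LowerBound.∑C≤directed C-opt aug sub cr)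

      -- All vertices together spend at most the optimum, hence at most the weight of G, so no
      -- single one can have paid `BIG`.
      own<BIG : ∀ v → v ≢ root → own v (tg v) (ch v) < BIG
      own<BIG v v≢r = ≤-<-trans (≤-trans (≤-reflexive (sym (spent≡own v≢r))) (∑-elem spent (∈-allFin v)))
        (≤-<-trans (spent≤ adj (λ _ _ p → p) adj-crossing) adj<BIG)

      -- A choice along a tree edge merely hands the target on to a child and buys nothing.
      selected : Fin n → Fin n → Bool
      selected u v = not (treeEdge u v) ∧ (⌊ ch u Fin.≟ v ⌋ ∨ ⌊ ch v Fin.≟ u ⌋)

      selected-sym : ∀ u v → selected u v ≡ selected v u
      selected-sym u v = cong₂ (λ a b → not a ∧ b) (treeEdge-sym u v) (Bool.∨-comm ⌊ ch u Fin.≟ v ⌋ _)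

      -- Following the choices downwards as long as they are children reaches a chosen edge of G.
      chosen : ∀ v → v ≢ root →
        ∃ λ x → x ≢ root × Anc v x × ¬ Anc (up (depth v ∸ suc (tg v)) v) (ch x) × treeEdge x (ch x) ≡ false
      chosen = leaf-induction _ λ v ih v≢r → [ (λ q → descend v ih v≢r (proj₂ q)) ,
          (λ q → v , v≢r , (0 , refl) , cov⁻ v (tg v) (ch v) v≢r (tg< v v≢r) (proj₂ q) , proj₁ q) ]′
        (own-small {v} {tg v} {ch v} (own<BIG v v≢r))
        where
        descend : ∀ v → (∀ c → child c v ≡ true → c ≢ root →
            ∃ λ x → x ≢ root × Anc c x × ¬ Anc (up (depth c ∸ suc (tg c)) c) (ch x) × treeEdge x (ch x) ≡ false) →
          v ≢ root → child (ch v) v ≡ true →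
          ∃ λ x → x ≢ root × Anc v x × ¬ Anc (up (depth v ∸ suc (tg v)) v) (ch x) × treeEdge x (ch x) ≡ false
        descend v ih v≢r p with ih (ch v) p (child≢root p)
        ... | x , x≢r , a , ¬b , nt = x , x≢r , anc-trans (1 , proj₂ (child⁻ (ch v) v p)) a ,
                subst (λ z → ¬ Anc z (ch x)) same ¬b , nt
          where
          -- The chosen child inherits the target, so both refer to the same ancestor.
          tg-same : tg (ch v) ≡ tg v
          tg-same = trans (tg-eq (ch v) (child≢root p)) pick
            where
            pick : (if ⌊ ch v Fin.≟ ch (par (ch v)) ⌋ then tg (par (ch v)) else depth (par (ch v))) ≡ tg v
            pick rewrite proj₂ (child⁻ (ch v) v p) | ≟-refl (ch v) = refl
          same : up (depth (ch v) ∸ suc (tg (ch v))) (ch v) ≡ up (depth v ∸ suc (tg v)) v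
          same = trans (cong (λ t → up (depth (ch v) ∸ suc t) (ch v)) tg-same) (up-child p (tg< v v≢r))

      ∑∑ : (Fin n → Fin n → ℕ) → ℕ
      ∑∑ F = ∑ V (λ u → ∑ V (F u))

      ∑∑-mono : ∀ {F G} → (∀ u v → F u v ≤ G u v) → ∑∑ F ≤ ∑∑ G
      ∑∑-mono le = ∑-mono V (λ u → ∑-mono V (le u))

      ∑∑-+ : ∀ F G → ∑∑ (λ u v → F u v + G u v) ≡ ∑∑ F + ∑∑ G
      ∑∑-+ F G = trans (∑-cong V (λ u → ∑-+ V (F u) (G u))) (∑-+ V _ _)

      once : (Fin n → Fin n → Bool) → Fin n → Fin n → ℕ
      once aug u v = when (aug u v ∧ (toℕ u <ᵇ toℕ v)) (w u v)

      cost-∑∑ : ∀ aug → cost I aug ≡ ∑∑ (once aug)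
      cost-∑∑ aug = ∑-cartesianProduct V V _

      directed≤2cost : ∀ aug → (∀ u v → aug u v ≡ aug v u) → (∀ u v → aug u v ≡ true → adj u v ≡ true) →
        directed aug ≤ 2 * cost I aug
      directed≤2cost aug a-sym sub = begin
        directed aug                                            ≤⟨ ∑∑-mono split ⟩
        ∑∑ (λ u v → once aug u v + once aug v u)                ≡⟨ ∑∑-+ (once aug) _ ⟩
        ∑∑ (once aug) + ∑∑ (λ u v → once aug v u)               ≡⟨ cong (∑∑ (once aug) +_) (∑-swap V V _) ⟩
        ∑∑ (once aug) + ∑∑ (once aug)                           ≡⟨ cong (∑∑ (once aug) +_) (sym (+-identityʳ _)) ⟩
        2 * ∑∑ (once aug)                                       ≡⟨ cong (2 *_) (sym (cost-∑∑ aug)) ⟩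
        2 * cost I aug                                          ∎
        where
        open ≤-Reasoning
        split : ∀ u v → when (aug u v) (w u v) ≤ once aug u v + once aug v u
        split u v with aug u v in eq
        ... | false = z≤n
        ... | true with <-cmp (toℕ u) (toℕ v)
        ... | tri< u<v _ _ rewrite T⇒true (<⇒<ᵇ u<v) = m≤m+n _ _
        ... | tri> _ _ v<u rewrite trans (sym (a-sym u v)) eq | T⇒true (<⇒<ᵇ v<u) | w-sym v u = m≤n+m _ _
        ... | tri≈ _ u≡v _ with Fin.toℕ-injective u≡v
        ... | refl = ⊥-elim (true≢false (sub u u eq) (adj-irrefl u))

      picked : Fin n → Fin n → ℕ
      picked u v = when ⌊ ch u Fin.≟ v ⌋ (when (adj u v ∧ not (treeEdge u v)) (w u v))

      module Output (sel : Fin n → Fin n → Bool)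
                    (sel-eq : ∀ u v → adj u v ≡ true → sel u v ≡ selected u v) where

        aug : Fin n → Fin n → Bool
        aug u v = adj u v ∧ sel u v

        aug-eq : ∀ u v → aug u v ≡ adj u v ∧ selected u v
        aug-eq u v with adj u v in p
        ... | true  = sel-eq u v p
        ... | false = refl

        aug-sym : ∀ u v → aug u v ≡ aug v u
        aug-sym u v = trans (aug-eq u v) (trans (cong₂ _∧_ (adj-sym u v) (selected-sym u v)) (sym (aug-eq v u)))

        aug-crossing : ∀ z → z ≢ root → Crossing aug z
        aug-crossing z z≢r with chosen z z≢r
        ... | x , x≢r , a , ¬b , nt = x , ch x , a ,
              -- The far end avoids the subtree of an ancestor of `z`, hence that of `z`.
              (λ q → ¬b (anc-trans (depth z ∸ suc (tg z) , refl) q)) ,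
              trans (aug-eq x (ch x)) (∧-true (ch-adj x x≢r) (∧-true (cong not nt) (∨-trueˡ _ (≟-refl (ch x))))) , nt

        aug-feasible : Feasible I aug
        aug-feasible = aug-sym , (λ u v p → proj₁ (∧-true⁻ p)) , crossing⇒2ec aug aug-sym aug-crossing

        -- Each selected edge is charged to an endpoint that chose it, and a vertex chooses only
        -- once. An edge chosen from both ends is paid for twice on the right.
        cost≤spent : cost I aug ≤ ∑ V spent
        cost≤spent = begin
          cost I aug
            ≡⟨ cost-∑∑ aug ⟩
          ∑∑ (once aug)
            ≤⟨ ∑∑-mono (λ u v → ≤-trans (≤-reflexive (cong (λ b → when (b ∧ (toℕ u <ᵇ toℕ v)) (w u v)) (aug-eq u v))) (split u v)) ⟩
          ∑∑ (λ u v → when (toℕ u <ᵇ toℕ v) (picked u v) + when (toℕ u <ᵇ toℕ v) (picked v u))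
            ≡⟨ ∑∑-+ _ _ ⟩
          ∑∑ (λ u v → when (toℕ u <ᵇ toℕ v) (picked u v)) + ∑∑ (λ u v → when (toℕ u <ᵇ toℕ v) (picked v u))
            ≡⟨ cong (∑∑ (λ u v → when (toℕ u <ᵇ toℕ v) (picked u v)) +_) (∑-swap V V _) ⟩
          ∑∑ (λ u v → when (toℕ u <ᵇ toℕ v) (picked u v)) + ∑∑ (λ u v → when (toℕ v <ᵇ toℕ u) (picked u v))
            ≡⟨ ∑∑-+ _ _ ⟨
          ∑∑ (λ u v → when (toℕ u <ᵇ toℕ v) (picked u v) + when (toℕ v <ᵇ toℕ u) (picked u v))
            ≤⟨ ∑∑-mono (λ u v → merge u v (picked u v)) ⟩
          ∑∑ picked
            ≤⟨ ∑-mono V pay ⟩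
          ∑ V spent ∎
          where
          open ≤-Reasoning
          bools : ∀ a t p q x → when (a ∧ not t ∧ (p ∨ q)) x ≤ when p (when (a ∧ not t) x) + when q (when (a ∧ not t) x)
          bools false t     p     q     x = z≤n
          bools true  true  p     q     x = z≤n
          bools true  false true  q     x = m≤m+n x _
          bools true  false false true  x = ≤-refl
          bools true  false false false x = z≤n
          split : ∀ u v → once (λ u v → adj u v ∧ selected u v) u v ≤ when (toℕ u <ᵇ toℕ v) (picked u v) + when (toℕ u <ᵇ toℕ v) (picked v u)
          split u v rewrite adj-sym v u | treeEdge-sym v u | w-sym v u with toℕ u <ᵇ toℕ v
          ... | true  rewrite Bool.∧-identityʳ (adj u v ∧ selected u v) =
                bools (adj u v) (treeEdge u v) ⌊ ch u Fin.≟ v ⌋ ⌊ ch v Fin.≟ u ⌋ (w u v)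
          ... | false rewrite Bool.∧-zeroʳ (adj u v ∧ selected u v) = z≤n
          merge : ∀ (u v : Fin n) x → when (toℕ u <ᵇ toℕ v) x + when (toℕ v <ᵇ toℕ u) x ≤ x
          merge u v x with toℕ u <ᵇ toℕ v in p | toℕ v <ᵇ toℕ u in q
          ... | true  | true  = contradiction (<ᵇ⇒< (toℕ v) (toℕ u) (true⇒T q)) (<⇒≯ (<ᵇ⇒< (toℕ u) (toℕ v) (true⇒T p)))
          ... | true  | false = ≤-reflexive (+-identityʳ x)
          ... | false | true  = ≤-refl
          ... | false | false = z≤n
          w<BIG : ∀ u v → adj u v ≡ true → w u v < BIG
          w<BIG u v p = ≤-<-trans (≤-trans (≤-reflexive (sym (when-true (w u v) p)))
            (≤-trans (∑-elem (λ v → when (adj u v) (w u v)) (∈-allFin v))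
                     (∑-elem (λ u → ∑ V (λ v → when (adj u v) (w u v))) (∈-allFin u)))) adj<BIG
          choice-cost : ∀ u → adj u (ch u) ≡ true →
            when (not (treeEdge u (ch u))) (w u (ch u)) ≤ own u (tg u) (ch u)
          choice-cost u p = pick (treeEdge u (ch u)) (child (ch u) u) (cov u (tg u) (ch u)) (<⇒≤ (w<BIG u (ch u) p))
            where
            pick : ∀ t c k {x} → x ≤ BIG → when (not t) x ≤ (if t then (if c then 0 else BIG) else (if k then x else BIG))
            pick true  c k     le = z≤n
            pick false c true  le = ≤-refl
            pick false c false le = le
          one : ∀ u → Dec (u ≡ root) → when (adj u (ch u) ∧ not (treeEdge u (ch u))) (w u (ch u)) ≤ spent u
          one u (yes refl) = ≤-trans (≤-reflexive (cong (λ b → when (b ∧ not (treeEdge root (ch root))) (w root (ch root)))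
            (trans (cong (adj root) ch-root) (adj-irrefl root)))) z≤n
          one u (no u≢r) = ≤-trans (≤-reflexive (cong (λ b → when (b ∧ not (treeEdge u (ch u))) (w u (ch u))) (ch-adj u u≢r)))
            (≤-trans (choice-cost u (ch-adj u u≢r)) (≤-reflexive (sym (spent≡own u≢r))))
          pay : ∀ u → ∑ V (picked u) ≤ spent u
          pay u = ≤-trans (≤-reflexive (∑-delta′ (ch u) _)) (one u (u Fin.≟ root))

        aug-2-approx : ∀ aug′ → Feasible I aug′ → cost I aug ≤ 2 * cost I aug′
        aug-2-approx aug′ fe@(s , sub , _) = begin
          cost I aug       ≤⟨ cost≤spent ⟩
          ∑ V spent        ≤⟨ spent≤ aug′ sub (feasible⇒crossing fe) ⟩
          directed aug′    ≤⟨ directed≤2cost aug′ s sub ⟩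
          2 * cost I aug′  ∎
          where open ≤-Reasoning

-- Algorithms that broadcast a fixed number of values, and the program for tree augmentation

module Broadcast (k B : ℕ) where

  History : Set
  History = ℕ → ℕ → Fin k → ℕ

  base : ℕ → ℕ
  base n = suc (suc n) ^ B

  instance
    base≢0 : ∀ {n} → NonZero (base n)
    base≢0 {n} = m^n≢0 (suc (suc n)) B

    base^k≢0 : ∀ {n} → NonZero (base n ^ k)
    base^k≢0 {n} = m^n≢0 (base n) k

  toℕ-mod : ∀ m d .{{_ : NonZero d}} → toℕ (m mod d) ≡ m % d
  toℕ-mod m d = Fin.toℕ-fromℕ< (m%n<n m d)

  -- The `k` numbers become the digits of one message. Reducing each of them keeps messages short
  -- for every program; that nothing is lost has to be shown for the program at hand.
  digits : ∀ n → (Fin k → ℕ) → Fin k → Fin (base n)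
  digits n f i = f i mod base n

  encode : ℕ → (Fin k → ℕ) → ℕ
  encode n f = toℕ (funToFin (digits n f))

  decode : ℕ → ℕ → Fin k → ℕ
  decode n m i = toℕ (finToFun {base n} (m mod (base n ^ k)) i)

  decode-encode : ∀ n f i → decode n (encode n f) i ≡ f i % base n
  decode-encode n f i = begin
    toℕ (finToFun {base n} (encode n f mod (base n ^ k)) i)
      ≡⟨ cong (λ x → toℕ (finToFun {base n} x i)) (Fin.toℕ-injective
           (trans (toℕ-mod (encode n f) (base n ^ k)) (m<n⇒m%n≡m (Fin.toℕ<n (funToFin (digits n f)))))) ⟩
    toℕ (finToFun {base n} (funToFin (digits n f)) i)
      ≡⟨ cong toℕ (Fin.finToFun-funToFin (digits n f) i) ⟩
    toℕ (f i mod base n)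
      ≡⟨ toℕ-mod (f i) (base n) ⟩
    f i % base n ∎
    where open ≡-Reasoning

  encode< : ∀ n f → encode n f < (n + 2) ^ (B * k)
  encode< n f = ≤-trans (Fin.toℕ<n (funToFin (digits n f)))
    (≤-reflexive (trans (^-*-assoc (suc (suc n)) B k) (cong (_^ (B * k)) (+-comm 2 n))))

  messageFrom : ℕ → List (ℕ × Maybe ℕ) → ℕ
  messageFrom x []                     = 0
  messageFrom x ((y , just m)  ∷ rest) = if y ≡ᵇ x then m else messageFrom x rest
  messageFrom x ((y , nothing) ∷ rest) = messageFrom x rest

  -- emit L h t gives the k numbers broadcast in round t by a vertex with local input L, where
  -- h s x holds the numbers that it received in round s < t from the neighbour with identifier x.
  record Program : Set where
    field
      emit   : LocalInput → History → ℕ → Fin k → ℕ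
      decide : LocalInput → History → ℕ → Maybe (ℕ → Bool)

  record LocalState : Set where
    constructor ⟨_,_,_⟩
    field
      input : LocalInput
      time  : ℕ
      heard : History

  module _ (P : Program) where
    open Program P
    open LocalState

    algorithm : Algorithm
    algorithm = record
      { State   = LocalState
      ; init    = λ L → ⟨ L , 0 , (λ _ _ _ → 0) ⟩
      ; send    = λ σ _ → just (encode (proj₁ (input σ)) (emit (input σ) (heard σ) (time σ)))
      ; receive = λ σ inbox → ⟨ input σ , suc (time σ) , (λ s x →
          if s ≡ᵇ time σ then decode (proj₁ (input σ)) (messageFrom x inbox) else heard σ s x) ⟩
      ; output  = λ σ → decide (input σ) (heard σ) (time σ)
      }

    module Run {n : ℕ} (I : Instance n) where
      open Instance I
      open Tree I

      inputOf : Fin n → LocalInput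
      inputOf = localInput algorithm I

      heardBy : ℕ → Fin n → History
      heardBy t v = heard (stateAt algorithm I t v)

      abstract
        -- The numbers after reduction, as the neighbours receive them.
        run : ℕ → Fin n → Fin k → ℕ
        run t v i = emit (inputOf v) (heardBy t v) t i % base n

        run-def : ∀ t v i → run t v i ≡ emit (inputOf v) (heardBy t v) t i % base n
        run-def t v i = refl

      state-input : ∀ t v → input (stateAt algorithm I t v) ≡ inputOf v
      state-input zero    v = refl
      state-input (suc t) v = state-input t v

      state-time : ∀ t v → time (stateAt algorithm I t v) ≡ t
      state-time zero    v = refl
      state-time (suc t) v = cong suc (state-time t v)

      output-eq : ∀ t v → Algorithm.output algorithm (stateAt algorithm I t v) ≡ decide (inputOf v) (heardBy t v) t
      output-eq t v = cong₂ (λ L s → decide L (heardBy t v) s) (state-input t v) (state-time t v)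

      message : ℕ → Fin n → ℕ
      message t u = encode n (emit (inputOf u) (heardBy t u) t)

      send-eq : ∀ t u x → Algorithm.send algorithm (stateAt algorithm I t u) x ≡ just (message t u)
      send-eq t u x = cong₂ (λ L s → just (encode (proj₁ L) (emit L (heardBy t u) s))) (state-input t u) (state-time t u)

      send< : ∀ t u x m → Algorithm.send algorithm (stateAt algorithm I t u) x ≡ just m → m < (n + 2) ^ (B * k)
      send< t u x m eq = subst (_< (n + 2) ^ (B * k)) (just-injective (trans (sym (send-eq t u x)) eq))
        (encode< n (emit (inputOf u) (heardBy t u) t))

      messageFrom-neighbour : ∀ (g : Fin n → Maybe ℕ) (f : Fin n → ℕ) → (∀ u → g u ≡ just (f u)) →
        ∀ {u} xs → u ∈ xs → messageFrom (ident u) (map (λ u → ident u , g u) xs) ≡ f u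
      messageFrom-neighbour g f eq {u} (x ∷ xs) p with g x | eq x
      ... | _ | refl with ident x ≡ᵇ ident u in e
      ... | true = cong f (ident-inj (≡ᵇ⇒≡ (ident x) (ident u) (true⇒T e)))
      ... | false with p
      ... | here refl = ⊥-elim (true≢false (T⇒true (≡⇒≡ᵇ (ident x) (ident x) refl)) e)
      ... | there q   = messageFrom-neighbour g f eq xs q

      -- Round `s` fills slot `s` of the history, and later rounds leave that slot alone.
      heard-eq : ∀ {s t u v} → s < t → adj v u ≡ true → ∀ i → heardBy t v s (ident u) i ≡ run s u i
      heard-eq {s} {suc t} {u} {v} s<1+t p i with s ≡ᵇ time (stateAt algorithm I t v) in e
      ... | true with trans (≡ᵇ⇒≡ s _ (true⇒T e)) (state-time t v)
      ... | refl = begin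
        decode (proj₁ (input (stateAt algorithm I t v))) (messageFrom (ident u) (map (λ u → ident u , sent u) (nbrs v))) i
          ≡⟨ cong₂ (λ L m → decode (proj₁ L) m i) (state-input t v)
               (messageFrom-neighbour sent (message t) (λ u → send-eq t u (ident v)) (nbrs v) (∈-nbrs p)) ⟩
        decode n (message t u) i
          ≡⟨ decode-encode n (emit (inputOf u) (heardBy t u) t) i ⟩
        emit (inputOf u) (heardBy t u) t i % base n
          ≡⟨ run-def t u i ⟨
        run t u i ∎
        where
        open ≡-Reasoning
        sent : Fin n → Maybe ℕ
        sent u = Algorithm.send algorithm (stateAt algorithm I t u) (ident v)
      heard-eq {s} {suc t} {u} {v} s<1+t p i | false = heard-eq (≤∧≢⇒< (≤-pred s<1+t) s≢t) p i
        where
        s≢t : s ≢ t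
        s≢t refl = true≢false (T⇒true (≡⇒≡ᵇ s _ (sym (state-time s v)))) e

-- ANC streams the identifiers of the ancestors; DEP, HGT and TAU hold one plus the depth, the height
-- of the subtree and the height of T respectively, or 0 while unknown; DP carries the table C;
-- TG and CH are the depth up to which a vertex has to cover and the neighbour chosen to do so.
pattern ANC = zero
pattern DEP = suc zero
pattern HGT = suc (suc zero)
pattern TAU = suc (suc (suc zero))
pattern DP  = suc (suc (suc (suc zero)))
pattern TG  = suc (suc (suc (suc (suc zero))))
pattern CH  = suc (suc (suc (suc (suc (suc zero)))))

-- The computation at a single vertex

EdgeInfo : Set
EdgeInfo = ℕ × ℕ × Bool × Bool

idOf weightOf : EdgeInfo → ℕ
idOf     (x , w , t , p) = x
weightOf (x , w , t , p) = w

isTree isUp isDown : EdgeInfo → Bool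
isTree (x , w , t , p) = t
isUp   (x , w , t , p) = p
isDown (x , w , t , p) = t ∧ not p

anyBelow : ℕ → (ℕ → Bool) → Bool
anyBelow zero    p = false
anyBelow (suc k) p = p k ∨ anyBelow k p

best : List (ℕ × ℕ) → ℕ × ℕ
best []           = 0 , 0
best (x ∷ [])     = x
best (x ∷ y ∷ xs) = let m = best (y ∷ xs) in if proj₁ x ≤ᵇ proj₁ m then x else m

-- Zero means unknown and has to remain so.
bump : ℕ → ℕ
bump zero    = zero
bump (suc x) = suc (suc x)

answer : List (ℕ × Bool) → ℕ → Bool
answer []             x = false
answer ((y , b) ∷ ys) x = if y ≡ᵇ x then b else answer ys x

-- Two extra factors n + 2 beat the number of ordered pairs, each of weight below (n + 2) ^ W.
big : ℕ → ℕ → ℕ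
big W n = suc (suc n) ^ suc (suc W)

-- Everything is computed in every round, even before its inputs have arrived; the value is
-- meaningful only from a suitable round on.
module Local (W : ℕ) (L : LocalInput) (rcv : ℕ → ℕ → Fin 7 → ℕ) (t : ℕ) where

  self : ℕ
  self = proj₁ (proj₂ L)

  edges : List EdgeInfo
  edges = proj₂ (proj₂ L)

  prev : ℕ → ℕ → Fin 7 → ℕ
  prev zero    x i = 0
  prev (suc s) x i = rcv s x i

  isRoot : Bool
  isRoot = ∑ edges (λ e → when (isUp e) 1) ≡ᵇ 0

  -- At most one summand is present, so the sum is a selection.
  parentId : ℕ
  parentId = ∑ edges (λ e → when (isUp e) (idOf e))

  -- In round `s` the parent sends its own `s`-th ancestor, which is the next one up for this
  -- vertex.
  ancestor : ℕ → ℕ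
  ancestor zero    = self
  ancestor (suc s) = if isRoot then self else rcv s parentId ANC

  depth+1 : ℕ
  depth+1 = if isRoot then 1 else bump (prev t parentId DEP)

  heightReady : Bool
  heightReady = and (map (λ e → not (isDown e) ∨ (0 <ᵇ prev t (idOf e) HGT)) edges)

  height+1 : ℕ
  height+1 = when heightReady (suc (foldr _⊔_ 0 (map (λ e → when (isDown e) (prev t (idOf e) HGT)) edges)))

  τ : ℕ
  τ = if isRoot then height+1 else prev t parentId TAU

  d : ℕ
  d = pred depth+1

  -- Once `τ` is known it exceeds every depth, so the first `τ` identifiers streamed by a neighbour
  -- list the neighbour and all its ancestors.
  covers : ℕ → EdgeInfo → Bool
  covers a e = not (anyBelow τ (λ j → rcv j (idOf e) ANC ≡ᵇ ancestor (d ∸ suc a)))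

  ownCost : ℕ → EdgeInfo → ℕ
  ownCost a e = if isTree e then (if isDown e then 0 else big W (proj₁ L))
                else (if covers a e then weightOf e else big W (proj₁ L))

  entry : EdgeInfo → ℕ → ℕ
  entry c a = rcv (4 * τ ∸ suc d ∸ a) (idOf c) DP

  optionValue : ℕ → EdgeInfo → ℕ
  optionValue a e = ownCost a e +
    ∑ edges (λ c → when (isDown c) (if idOf c ≡ᵇ idOf e then entry c a else entry c d))

  options : ℕ → List (ℕ × ℕ)
  options a = map (λ e → optionValue a e , idOf e) edges

  -- Round `s` is the one in which the parent, of depth `pred d`, announces its choice. A chosen
  -- child inherits the target; any other covers just its parent edge.
  target : ℕ
  target = let s = 4 * τ + pred d in
    if rcv s parentId CH ≡ᵇ self then rcv s parentId TG else pred d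

  -- The root announces itself, which no child can mistake for being chosen.
  choice : ℕ
  choice = if isRoot then self else proj₂ (best (options target))

  answers : List (ℕ × Bool)
  answers = map (λ e → idOf e , not (isTree e) ∧ ((choice ≡ᵇ idOf e) ∨ (rcv (5 * τ) (idOf e) CH ≡ᵇ self))) edges

  emission : Fin 7 → ℕ
  emission ANC = ancestor t
  emission DEP = depth+1
  emission HGT = height+1
  emission TAU = τ
  -- The schedule solved for the index: entry `a` is due in round `4 * τ ∸ d ∸ a`.
  emission DP  = proj₁ (best (options (4 * τ ∸ d ∸ t)))
  emission TG  = target
  emission CH  = choice

  decision : Maybe (ℕ → Bool)
  -- While `τ` is unknown it is 0 and the second test alone would succeed at once.
  decision = if (0 <ᵇ τ) ∧ (6 * τ ≤ᵇ t) then just (answer answers) else nothing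

-- The values sent in the individual rounds

and⁻ : ∀ {A : Set} (p : A → Bool) {x} xs → and (map p xs) ≡ true → x ∈ xs → p x ≡ true
and⁻ p (y ∷ xs) e (here refl) = proj₁ (∧-true⁻ e)
and⁻ p (y ∷ xs) e (there q)   = and⁻ p xs (proj₂ (∧-true⁻ {p y} e)) q

and⁺ : ∀ {A : Set} (p : A → Bool) xs → (∀ x → x ∈ xs → p x ≡ true) → and (map p xs) ≡ true
and⁺ p []       f = refl
and⁺ p (x ∷ xs) f = ∧-true (f x (here refl)) (and⁺ p xs (λ y q → f y (there q)))

anyBelow-cong : ∀ k {p q : ℕ → Bool} → (∀ j → j < k → p j ≡ q j) → anyBelow k p ≡ anyBelow k q
anyBelow-cong zero    eq = refl
anyBelow-cong (suc k) eq = cong₂ _∨_ (eq k ≤-refl) (anyBelow-cong k (λ j lt → eq j (m≤n⇒m≤1+n lt)))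

anyBelow⁺ : ∀ k {p : ℕ → Bool} j → j < k → p j ≡ true → anyBelow k p ≡ true
anyBelow⁺ (suc k) {p} j (s≤s j≤k) e with j ≟ k
... | yes refl = ∨-trueˡ _ e
... | no j≢k   = ∨-trueʳ (p k) (anyBelow⁺ k j (≤∧≢⇒< j≤k j≢k) e)

anyBelow⁻ : ∀ k {p : ℕ → Bool} → anyBelow k p ≡ true → ∃ λ j → p j ≡ true
anyBelow⁻ (suc k) {p} e with ∨-true⁻ {p k} e
... | inj₁ q = k , q
... | inj₂ q = anyBelow⁻ k q

best-∈ : ∀ x xs → best (x ∷ xs) ∈ x ∷ xs
best-∈ x []       = here refl
best-∈ x (y ∷ xs) with proj₁ x ≤ᵇ proj₁ (best (y ∷ xs))
... | true  = here refl
... | false = there (best-∈ y xs)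

best-min : ∀ {x} xs → x ∈ xs → proj₁ (best xs) ≤ proj₁ x
best-min (x ∷ []) (here refl) = ≤-refl
best-min (x ∷ y ∷ xs) p with proj₁ x ≤ᵇ proj₁ (best (y ∷ xs)) in e
best-min (x ∷ y ∷ xs) (here refl) | true  = ≤-refl
best-min (x ∷ y ∷ xs) (there q)   | true  = ≤-trans (≤ᵇ⇒≤ (proj₁ x) _ (true⇒T e)) (best-min (y ∷ xs) q)
best-min (x ∷ y ∷ xs) (here refl) | false =
  <⇒≤ (≰⇒> (λ le → true≢false (T⇒true (≤⇒≤ᵇ le)) e))
best-min (x ∷ y ∷ xs) (there q)   | false = best-min (y ∷ xs) q

<ᵇ-true : ∀ {a b} → a < b → (a <ᵇ b) ≡ true
<ᵇ-true lt = T⇒true (<⇒<ᵇ lt)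

<ᵇ-false : ∀ {a b} → b ≤ a → (a <ᵇ b) ≡ false
<ᵇ-false {a} {b} le = ¬true⇒false (λ e → <⇒≱ (<ᵇ⇒< a b (true⇒T e)) le)

bump-when : ∀ b x → bump (when b (suc x)) ≡ when b (suc (suc x))
bump-when true  x = refl
bump-when false x = refl

module Analysis (W K : ℕ) {n : ℕ} (I : Instance n) where
  open Instance I
  open Tree I
  open Approximation I
  open Broadcast 7 (W + K + 3)

  program : Program
  program = record { emit = Local.emission W ; decide = Local.decision W }

  open Run program I

  module At (t : ℕ) (v : Fin n) = Local W (inputOf v) (heardBy t v) t

  edge : Fin n → Fin n → EdgeInfo
  edge v u = ident u , w v u , treeEdge v u , child v u

  edges-map : ∀ v {A : Set} {F : EdgeInfo → A} {G : Fin n → A} →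
    (∀ u → adj v u ≡ true → F (edge v u) ≡ G u) →
    map F (map (edge v) (nbrs v)) ≡ map G (nbrs v)
  edges-map v eq = trans (sym (map-∘ (nbrs v)))
    (map-cong-local (All.tabulate (λ {u} p → eq u (nbrs-adj p))))

  isDown-edge : ∀ v u → isDown (edge v u) ≡ child u v
  isDown-edge v u = pick (child v u) (child u v) child-asym
    where
    pick : ∀ a b → (a ≡ true → b ≡ false) → (a ∨ b) ∧ not a ≡ b
    pick true  b f = sym (f refl)
    pick false b f = Bool.∧-identityʳ b

  ident-≡ᵇ : ∀ u v → (ident u ≡ᵇ ident v) ≡ ⌊ u Fin.≟ v ⌋
  ident-≡ᵇ u v with u Fin.≟ v
  ... | yes refl = T⇒true (≡⇒≡ᵇ (ident u) _ refl)
  ... | no u≢v   = ¬true⇒false (λ e → u≢v (ident-inj (≡ᵇ⇒≡ (ident u) _ (true⇒T e))))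

  ∑-nbrs : ∀ v (b : Fin n → Bool) → (∀ u → b u ≡ true → adj v u ≡ true) → (g : Fin n → ℕ) →
    ∑ (nbrs v) (λ u → when (b u) (g u)) ≡ ∑ V (λ u → when (b u) (g u))
  ∑-nbrs v b sub g = trans (∑-filter (adj v) _ V) (∑-cong V (λ u → pick (adj v u) (b u) (sub u)))
    where
    pick : ∀ a b {x} → (b ≡ true → a ≡ true) → when a (when b x) ≡ when b x
    pick true  b     f = refl
    pick false true  f = contradiction (f refl) (λ ())
    pick false false f = refl

  ∑-child : ∀ v (g : Fin n → ℕ) → ∑ (nbrs v) (λ c → when (child c v) (g c)) ≡ ∑child v g
  ∑-child v = ∑-nbrs v (λ c → child c v) (λ c → child-adj)

  child-par-adj : ∀ v u → child v u ≡ true → adj v u ≡ true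
  child-par-adj v u p = trans (adj-sym v u) (child-adj p)

  ∑-parent : ∀ v (g : Fin n → ℕ) → ∑ (nbrs v) (λ u → when (child v u) (g u)) ≡ when (not ⌊ v Fin.≟ root ⌋) (g (par v))
  ∑-parent v g = trans (∑-nbrs v (child v) (child-par-adj v) g)
    (trans (∑-cong V (λ u → when-∧ (not ⌊ v Fin.≟ root ⌋) ⌊ par v Fin.≟ u ⌋ (g u)))
      (trans (∑-when (not ⌊ v Fin.≟ root ⌋) V _) (cong (when (not ⌊ v Fin.≟ root ⌋)) (∑-delta′ (par v) g))))

  ≟-false : ∀ {v} → v ≢ root → ⌊ v Fin.≟ root ⌋ ≡ false
  ≟-false {v} v≢r with v Fin.≟ root
  ... | yes p = contradiction p v≢r
  ... | no _  = refl

  isRoot-eq : ∀ t v → At.isRoot t v ≡ ⌊ v Fin.≟ root ⌋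
  isRoot-eq t v = trans (cong (λ xs → sum xs ≡ᵇ 0) (edges-map v (λ u _ → refl)))
    (trans (cong (_≡ᵇ 0) (∑-parent v (λ _ → 1))) (pick ⌊ v Fin.≟ root ⌋))
    where
    pick : ∀ b → (when (not b) 1 ≡ᵇ 0) ≡ b
    pick true  = refl
    pick false = refl

  if-root : ∀ t {A : Set} {x y : A} → (if At.isRoot t root then x else y) ≡ x
  if-root t {x = x} {y} = cong (λ b → if b then x else y) (trans (isRoot-eq t root) (≟-refl root))

  if-nonroot : ∀ t {v} {A : Set} {x y : A} → v ≢ root → (if At.isRoot t v then x else y) ≡ y
  if-nonroot t {v} {x = x} {y} v≢r = cong (λ b → if b then x else y) (trans (isRoot-eq t v) (≟-false v≢r))

  parentId-eq : ∀ t {v} → v ≢ root → At.parentId t v ≡ ident (par v)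
  parentId-eq t {v} v≢r = trans (cong sum (edges-map v (λ u _ → refl)))
    (trans (∑-parent v ident) (cong (λ b → when (not b) (ident (par v))) (≟-false v≢r)))

  hear-parent : ∀ {s t v} → v ≢ root → s < t → ∀ i → heardBy t v s (At.parentId t v) i ≡ run s (par v) i
  hear-parent {s} {t} {v} v≢r s<t i =
    trans (cong (λ x → heardBy t v s x i) (parentId-eq t v≢r)) (heard-eq s<t (par-adj v v≢r) i)

  pow≤base : ∀ {j} → j ≤ W + K + 3 → suc (suc n) ^ j ≤ base n
  pow≤base = ^-monoʳ-≤ (suc (suc n))

  run-small : ∀ t v i {x} → Local.emission W (inputOf v) (heardBy t v) t i ≡ x → x < base n → run t v i ≡ x
  run-small t v i refl lt = trans (run-def t v i) (m<n⇒m%n≡m lt)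

  2+n≤base : 2 + n ≤ base n
  2+n≤base = ≤-trans (≤-reflexive (sym (^-identityʳ (2 + n)))) (pow≤base (≤-trans (s≤s z≤n) (m≤n+m 3 (W + K))))

  hs-step : Fin n → (Fin n → ℕ) → ℕ
  hs-step v g = foldr _⊔_ 0 (map (λ c → when (child c v) (suc (g c))) (nbrs v))

  open Fold hs-step public using () renaming (fold to hs; fold-eq to hs-eq′)

  hs-eq : ∀ v → hs v ≡ hs-step v hs
  hs-eq = hs-eq′ λ v g h eq → cong (foldr _⊔_ 0) (map-cong (λ c → when-cong refl (λ p → cong suc (eq c p))) (nbrs v))

  hs-child : ∀ {c v} → child c v ≡ true → suc (hs c) ≤ hs v
  hs-child {c} {v} p = ≤-trans (≤-reflexive (sym (when-true (suc (hs c)) p)))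
    (≤-trans (foldr-⊔-elem (∈-map⁺ (λ c → when (child c v) (suc (hs c))) (∈-nbrs (child-adj p)))) (≤-reflexive (sym (hs-eq v))))

  hs-lub : ∀ {v m} → (∀ c → child c v ≡ true → suc (hs c) ≤ m) → hs v ≤ m
  hs-lub {v} {m} le = ≤-trans (≤-reflexive (hs-eq v)) (foldr-⊔-lub _ (nbrs v) (λ c _ → pick (child c v) (le c)))
    where
    pick : ∀ b {x} → (b ≡ true → x ≤ m) → when b x ≤ m
    pick true  f = f refl
    pick false f = z≤n

  hs≤ : ∀ v → hs v ≤ height I ∸ depth v
  hs≤ = leaf-induction _ λ v ih → hs-lub λ c p → ≤-trans (s≤s (ih c p))
    (≤-reflexive (trans (cong (λ d → suc (height I ∸ d)) (child-depth p))
      (sym (∸-unsuc (≤-trans (≤-reflexive (sym (child-depth p))) (depth≤height c))))))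

  depth+hs≤ : ∀ v → depth v + hs v ≤ hs root
  depth+hs≤ = root-induction _ (≤-reflexive (cong (_+ hs root) depth-root)) λ v v≢r ih → begin
    depth v + hs v              ≡⟨ cong (_+ hs v) (depth-par v v≢r) ⟩
    suc (depth (par v) + hs v)  ≡⟨ +-suc (depth (par v)) (hs v) ⟨
    depth (par v) + suc (hs v)  ≤⟨ +-monoʳ-≤ (depth (par v)) (hs-child (child⁺ v (par v) v≢r refl)) ⟩
    depth (par v) + hs (par v)  ≤⟨ ih ⟩
    hs root                     ∎
    where open ≤-Reasoning

  abstract
    H : ℕ
    H = suc (hs root)

    H-def : H ≡ suc (hs root)
    H-def = refl

  0<H : 0 < H
  0<H = ≤-trans (s≤s z≤n) (≤-reflexive (sym H-def))

  depth<H : ∀ v → depth v < H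
  depth<H v = ≤-trans (s≤s (≤-trans (m≤m+n (depth v) (hs v)) (depth+hs≤ v))) (≤-reflexive (sym H-def))

  H≤ : H ≤ suc (height I)
  H≤ = ≤-trans (≤-reflexive H-def) (s≤s (≤-trans (hs≤ root) (m∸n≤m _ (depth root))))

  hs<n : ∀ v → hs v ≤ n
  hs<n v = ≤-trans (hs≤ v) (≤-trans (m∸n≤m _ (depth v)) (foldr-⊔-lub depth V (λ x _ → <⇒≤ (depth<n x))))

  DEP-val : ℕ → Fin n → ℕ
  DEP-val t v = when (depth v <ᵇ suc t) (suc (depth v))

  -- What is computed and what is sent are determined by simultaneous induction on the round. The
  -- heights, `τ` and the ancestors are treated in the same way.
  depth+1-eq : ∀ t v → At.depth+1 t v ≡ DEP-val t v
  run-DEP : ∀ t v → run t v DEP ≡ DEP-val t v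

  depth+1-eq t v = known t (v Fin.≟ root)
    where
    known : ∀ t → Dec (v ≡ root) → At.depth+1 t v ≡ DEP-val t v
    known t (yes refl) rewrite depth-root = if-root t
    known zero (no v≢r) = trans (if-nonroot 0 v≢r)
      (cong (λ b → when b (suc (depth v))) (sym (<ᵇ-false (depth>0 v≢r))))
    known (suc s) (no v≢r) = begin
      At.depth+1 (suc s) v
        ≡⟨ if-nonroot (suc s) v≢r ⟩
      bump (heardBy (suc s) v s (At.parentId (suc s) v) DEP)
        ≡⟨ cong bump (trans (hear-parent {s} {suc s} v≢r ≤-refl DEP) (run-DEP s (par v))) ⟩
      bump (DEP-val s (par v))
        ≡⟨ bump-when (depth (par v) <ᵇ suc s) (depth (par v)) ⟩
      when (suc (depth (par v)) <ᵇ suc (suc s)) (suc (suc (depth (par v))))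
        ≡⟨ cong (λ d → when (d <ᵇ suc (suc s)) (suc d)) (sym (depth-par v v≢r)) ⟩
      DEP-val (suc s) v ∎
      where open ≡-Reasoning

  run-DEP t v = run-small t v DEP (depth+1-eq t v)
    (≤-<-trans (when-≤ _ _) (≤-trans (s≤s (s≤s (<⇒≤ (depth<n v)))) 2+n≤base))

  HGT-val : ℕ → Fin n → ℕ
  HGT-val t v = when (hs v <ᵇ suc t) (suc (hs v))

  -- All children have reported before round `t` exactly when their heights are below `t`, that is,
  -- when `hs v` is at most `t`.
  height+1-eq : ∀ t v → At.height+1 t v ≡ HGT-val t v
  run-HGT : ∀ t v → run t v HGT ≡ HGT-val t v

  height+1-eq t v = trans
    (cong₂ (λ bs xs → when (and bs) (suc (foldr _⊔_ 0 xs)))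
      (edges-map v {F = λ e → not (isDown e) ∨ (0 <ᵇ At.prev t v t (idOf e) HGT)} {G = ready} (λ u p → cong₂ (λ a b → not a ∨ (0 <ᵇ b)) (isDown-edge v u) (prev-eq t p)))
      (edges-map v {F = λ e → when (isDown e) (At.prev t v t (idOf e) HGT)} {G = λ c → when (child c v) (P c)} (λ u p → cong₂ when (isDown-edge v u) (prev-eq t p))))
    (global (hs v <? suc t))
    where
    P : Fin n → ℕ
    P c = when (hs c <ᵇ t) (suc (hs c))
    ready : Fin n → Bool
    ready c = not (child c v) ∨ (0 <ᵇ P c)
    prev-eq : ∀ t {u} → adj v u ≡ true → At.prev t v t (ident u) HGT ≡ when (hs u <ᵇ t) (suc (hs u))
    prev-eq zero    {u} p = sym (cong (λ b → when b (suc (hs u))) (<ᵇ-false {hs u} z≤n))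
    prev-eq (suc s) {u} p = trans (heard-eq {s} {suc s} ≤-refl p HGT) (run-HGT s u)
    P-pos : ∀ c → (0 <ᵇ P c) ≡ (hs c <ᵇ t)
    P-pos c with hs c <ᵇ t
    ... | true  = refl
    ... | false = refl
    global : Dec (hs v < suc t) → when (and (map ready (nbrs v))) (suc (foldr _⊔_ 0 (map (λ c → when (child c v) (P c)) (nbrs v)))) ≡ HGT-val t v
    global (yes (s≤s hs≤t)) = trans
      (cong₂ (λ b xs → when b (suc (foldr _⊔_ 0 xs)))
        (and⁺ ready (nbrs v) (λ c _ → all-ready c))
        (map-cong {g = λ c → when (child c v) (suc (hs c))} (λ c → when-cong refl (λ p → cong (λ b → when b (suc (hs c))) (<ᵇ-true (early p)))) (nbrs v)))
      (trans (cong suc (sym (hs-eq v))) (cong (λ b → when b (suc (hs v))) (sym (<ᵇ-true {hs v} {suc t} (s≤s hs≤t)))))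
      where
      early : ∀ {c} → child c v ≡ true → hs c < t
      early p = ≤-trans (hs-child p) hs≤t
      all-ready : ∀ c → ready c ≡ true
      all-ready c with child c v in e
      ... | false = refl
      ... | true  = trans (P-pos c) (<ᵇ-true (early e))
    global (no hs>t) = trans (cong (λ b → when b (suc (foldr _⊔_ 0 (map (λ c → when (child c v) (P c)) (nbrs v))))) (¬true⇒false not-ready))
      (cong (λ b → when b (suc (hs v))) (sym (<ᵇ-false {hs v} {suc t} (≮⇒≥ hs>t))))
      where
      not-ready : and (map ready (nbrs v)) ≡ true → ⊥
      not-ready e = hs>t (s≤s (hs-lub λ c p → <ᵇ⇒< (hs c) t (true⇒T (trans (sym (P-pos c))
        (trans (cong (λ b → not b ∨ (0 <ᵇ P c)) (sym p)) (and⁻ ready (nbrs v) e (∈-nbrs (child-adj p))))))))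

  run-HGT t v = run-small t v HGT (height+1-eq t v)
    (≤-<-trans (when-≤ _ _) (≤-trans (s≤s (s≤s (hs<n v))) 2+n≤base))

  TAU-val : ℕ → Fin n → ℕ
  TAU-val t v = when (hs root + depth v <ᵇ suc t) H

  τ-val : ∀ t v → At.τ t v ≡ TAU-val t v
  run-TAU : ∀ t v → run t v TAU ≡ TAU-val t v

  τ-val t v = known t (v Fin.≟ root)
    where
    known : ∀ t → Dec (v ≡ root) → At.τ t v ≡ TAU-val t v
    known t (yes refl) = trans (if-root t) (trans (height+1-eq t root)
      (cong₂ (λ k x → when (k <ᵇ suc t) x) (sym (trans (cong (hs root +_) depth-root) (+-identityʳ _))) (sym H-def)))
    known zero (no v≢r) = trans (if-nonroot 0 v≢r)
      (cong (λ b → when b H) (sym (<ᵇ-false (≤-trans (depth>0 v≢r) (m≤n+m (depth v) (hs root))))))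
    known (suc s) (no v≢r) = begin
      At.τ (suc s) v
        ≡⟨ if-nonroot (suc s) v≢r ⟩
      heardBy (suc s) v s (At.parentId (suc s) v) TAU
        ≡⟨ trans (hear-parent {s} {suc s} v≢r ≤-refl TAU) (run-TAU s (par v)) ⟩
      when (suc (hs root + depth (par v)) <ᵇ suc (suc s)) H
        ≡⟨ cong (λ d → when (d <ᵇ suc (suc s)) H) (trans (sym (+-suc (hs root) (depth (par v)))) (cong (hs root +_) (sym (depth-par v v≢r)))) ⟩
      TAU-val (suc s) v ∎
      where open ≡-Reasoning

  run-TAU t v = run-small t v TAU (τ-val t v)
    (≤-<-trans (≤-trans (when-≤ _ H) (≤-reflexive H-def)) (≤-trans (s≤s (s≤s (hs<n root))) 2+n≤base))

  -- The height takes `hs root` rounds to be known at the root and `depth v` more to come down; both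
  -- are below `H`.
  τ-eq : ∀ {t v} → 2 * H ≤ t → At.τ t v ≡ H
  τ-eq {t} {v} late = trans (τ-val t v) (cong (λ b → when b H) (<ᵇ-true (s≤s (≤-trans
    (+-mono-≤ (≤-trans (n≤1+n (hs root)) (≤-reflexive (sym H-def))) (≤-trans (<⇒≤ (depth<H v)) (≤-reflexive (sym (+-identityʳ H))))) late))))

  d-eq : ∀ {t v} → 2 * H ≤ t → At.d t v ≡ depth v
  d-eq {t} {v} late = cong pred (trans (depth+1-eq t v) (cong (λ b → when b (suc (depth v))) (<ᵇ-true (s≤s (≤-trans
    (<⇒≤ (depth<H v)) (≤-trans (m≤m+n H (H + 0)) late))))))

-- Correctness of the table, the choices and the output

module Correctness (W K : ℕ) {n : ℕ} (I : Instance n) (w< : WeightsBounded W I) (id< : IdentsBounded K I) where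
  open Instance I
  open Tree I
  open Approximation I
  open Broadcast 7 (W + K + 3)
  open Analysis W K I
  open Run program I

  ident<base : ∀ v → ident v < base n
  ident<base v = <-≤-trans (id< v) (≤-trans (≤-reflexive (cong (_^ K) (+-comm n 2)))
    (pow≤base (≤-trans (m≤n+m K W) (m≤m+n (W + K) 3))))

  ancestor-eq : ∀ {t} v j → j ≤ t → At.ancestor t v j ≡ ident (up j v)
  run-ANC : ∀ t v → run t v ANC ≡ ident (up t v)

  ancestor-eq     v zero    le = refl
  ancestor-eq {t} v (suc s) lt = known (v Fin.≟ root)
    where
    known : Dec (v ≡ root) → At.ancestor t v (suc s) ≡ ident (up (suc s) v)
    known (yes refl) = trans (if-root t) (cong ident (sym (up-root (suc s))))
    known (no v≢r)   = trans (if-nonroot t v≢r) (trans (hear-parent v≢r lt ANC) (run-ANC s (par v)))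

  run-ANC t v = run-small t v ANC (ancestor-eq {t} v t ≤-refl) (ident<base (up t v))

  BIG : ℕ
  BIG = big W n

  -- The number sent in the scheduled round, reduction included; `C-eq` later removes the reduction.
  C : Fin n → ℕ → ℕ
  C v a = run (4 * H ∸ depth v ∸ a) v DP

  cov : Fin n → ℕ → Fin n → Bool
  cov v a u = not (anyBelow H (λ j → ident (up j u) ≡ᵇ ident (up (depth v ∸ suc a) v)))

  cov⁺ : ∀ v a u → v ≢ root → a < depth v → ¬ Anc (up (depth v ∸ suc a) v) u → cov v a u ≡ true
  cov⁺ v a u _ _ ¬anc = cong not (¬true⇒false λ e → found (anyBelow⁻ H e))
    where
    found : ¬ ∃ λ j → (ident (up j u) ≡ᵇ ident (up (depth v ∸ suc a) v)) ≡ true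
    found (j , e) = ¬anc (j , ident-inj (≡ᵇ⇒≡ (ident (up j u)) _ (true⇒T e)))

  cov⁻ : ∀ v a u → v ≢ root → a < depth v → cov v a u ≡ true → ¬ Anc (up (depth v ∸ suc a) v) u
  cov⁻ v a u _ _ e anc = true≢false e (cong not (anyBelow⁺ H (depth u ∸ depth (up (depth v ∸ suc a) v))
    (≤-<-trans (m∸n≤m (depth u) (depth (up (depth v ∸ suc a) v))) (depth<H u))
    (T⇒true (≡⇒≡ᵇ _ _ (cong ident (anc-level anc))))))

  open Table BIG C cov cov⁺ cov⁻

  options : Fin n → ℕ → List (ℕ × ℕ)
  options v a = map (λ u → value v a u , ident u) (nbrs v)

  -- Entries are sent only from round 2 H on, when every vertex knows H and its depth.
  dp-late : ∀ v a → a < depth v → 2 * H ≤ 4 * H ∸ depth v ∸ a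
  dp-late v a a<d = begin
    2 * H                      ≡⟨ m+n∸n≡m (2 * H) (2 * H) ⟨
    2 * H + 2 * H ∸ 2 * H      ≡⟨ cong (_∸ 2 * H) (sym (*-distribʳ-+ H 2 2)) ⟩
    4 * H ∸ 2 * H              ≤⟨ ∸-monoʳ-≤ (4 * H) (+-mono-≤ (<⇒≤ (depth<H v)) (≤-trans (<⇒≤ (<-trans a<d (depth<H v))) (m≤m+n H 0))) ⟩
    4 * H ∸ (depth v + a)      ≡⟨ ∸-+-assoc (4 * H) (depth v) a ⟨
    4 * H ∸ depth v ∸ a        ∎
    where open ≤-Reasoning

  -- The entries needed from children are those for `a` and for `depth v`. Neither index is below
  -- `a`, and larger indices are sent earlier.
  child-earlier : ∀ v a b → a < depth v → a ≤ b → 4 * H ∸ suc (depth v) ∸ b < 4 * H ∸ depth v ∸ a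
  child-earlier v a b a<d a≤b = begin-strict
    4 * H ∸ suc (depth v) ∸ b        ≤⟨ ∸-monoʳ-≤ (4 * H ∸ suc (depth v)) a≤b ⟩
    4 * H ∸ suc (depth v) ∸ a        ≡⟨ ∸-+-assoc (4 * H) (suc (depth v)) a ⟩
    4 * H ∸ suc (depth v + a)        <⟨ ≤-reflexive (sym (∸-unsuc room)) ⟩
    4 * H ∸ (depth v + a)            ≡⟨ ∸-+-assoc (4 * H) (depth v) a ⟨
    4 * H ∸ depth v ∸ a              ∎
    where
    open ≤-Reasoning
    -- Strictness requires that the truncated subtraction does not bottom out at 0.
    room : depth v + a < 4 * H
    room = ≤-trans (+-mono-<-≤ (depth<H v) (≤-trans (<⇒≤ (<-trans a<d (depth<H v))) (m≤m+n H (H + (H + 0))))) ≤-refl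

  -- All later rounds are included, because the options are evaluated again when the choice is made.
  module Late (t : ℕ) (v : Fin n) (a : ℕ) (v≢r : v ≢ root) (a<d : a < depth v) (ready : 4 * H ∸ depth v ∸ a ≤ t) where

    late : 2 * H ≤ t
    late = ≤-trans (dp-late v a a<d) ready

    covers-eq : ∀ u → adj v u ≡ true → At.covers t v a (edge v u) ≡ cov v a u
    covers-eq u p = cong not (trans
      (cong (λ k → anyBelow k (λ j → heardBy t v j (ident u) ANC ≡ᵇ At.ancestor t v (At.d t v ∸ suc a))) (τ-eq late))
      (anyBelow-cong H (λ j j<H → cong₂ _≡ᵇ_
        (trans (heard-eq (≤-trans j<H (≤-trans (m≤m+n H (H + 0)) late)) p ANC) (run-ANC j u))
        (trans (cong (λ d → At.ancestor t v (d ∸ suc a)) (d-eq late))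
          (ancestor-eq v (depth v ∸ suc a) (≤-trans (m∸n≤m (depth v) (suc a))
            (≤-trans (<⇒≤ (depth<H v)) (≤-trans (m≤m+n H (H + 0)) late))))))))

    ownCost-eq : ∀ u → adj v u ≡ true → At.ownCost t v a (edge v u) ≡ own v a u
    ownCost-eq u p = cong₂ (λ b c → if treeEdge v u then (if b then 0 else BIG) else (if c then w v u else BIG))
      (isDown-edge v u) (covers-eq u p)

    entry-eq : ∀ c b → child c v ≡ true → a ≤ b → At.entry t v (edge v c) b ≡ C c b
    entry-eq c b p a≤b = begin
      heardBy t v (4 * At.τ t v ∸ suc (At.d t v) ∸ b) (ident c) DP
        ≡⟨ cong₂ (λ τ d → heardBy t v (4 * τ ∸ suc d ∸ b) (ident c) DP) (τ-eq late) (d-eq late) ⟩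
      heardBy t v (4 * H ∸ suc (depth v) ∸ b) (ident c) DP
        ≡⟨ heard-eq (<-≤-trans (child-earlier v a b a<d a≤b) ready) (child-adj p) DP ⟩
      run (4 * H ∸ suc (depth v) ∸ b) c DP
        ≡⟨ cong (λ d → run (4 * H ∸ d ∸ b) c DP) (sym (child-depth p)) ⟩
      C c b ∎
      where open ≡-Reasoning

    optionValue-eq : ∀ u → adj v u ≡ true → At.optionValue t v a (edge v u) ≡ value v a u
    optionValue-eq u p = cong₂ _+_ (ownCost-eq u p)
      (trans (cong sum (edges-map v (λ c q → when-cong (isDown-edge v c) (entries c)))) (∑-child v _))
      where
      entries : ∀ c → child c v ≡ true →
        (if ident c ≡ᵇ ident u then At.entry t v (edge v c) a else At.entry t v (edge v c) (At.d t v)) ≡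
        (if ⌊ c Fin.≟ u ⌋ then C c a else C c (depth v))
      entries c q = trans (cong (λ b → if b then At.entry t v (edge v c) a else At.entry t v (edge v c) (At.d t v)) (ident-≡ᵇ c u))
        (cong₂ (λ x y → if ⌊ c Fin.≟ u ⌋ then x else y) (entry-eq c a q ≤-refl)
          (trans (cong (At.entry t v (edge v c)) (d-eq late)) (entry-eq c (depth v) q (<⇒≤ a<d))))

    options-eq : At.options t v a ≡ options v a
    options-eq = edges-map v (λ u p → cong (_, ident u) (optionValue-eq u p))

  C-mod : ∀ v a → v ≢ root → a < depth v → C v a ≡ proj₁ (best (options v a)) % base n
  C-mod v a v≢r a<d = trans (run-def t v DP) (cong (_% base n) (cong (proj₁ ∘ best)
    (trans (cong (At.options t v) index) (Late.options-eq t v a v≢r a<d ≤-refl))))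
    where
    t : ℕ
    t = 4 * H ∸ depth v ∸ a
    a≤ : a ≤ 4 * H ∸ depth v
    a≤ = <⇒≤ (m∸n≢0⇒n<m {4 * H ∸ depth v} {a} (λ e → <⇒≱ (≤-trans 0<H (m≤m+n H (H + 0))) (≤-trans (dp-late v a a<d) (≤-reflexive e))))
    index : 4 * At.τ t v ∸ At.d t v ∸ t ≡ a
    index = trans (cong₂ (λ τ d → 4 * τ ∸ d ∸ t) (τ-eq (dp-late v a a<d)) (d-eq (dp-late v a a<d))) (m∸[m∸n]≡n a≤)

  best≤ : ∀ v a u → adj v u ≡ true → proj₁ (best (options v a)) ≤ value v a u
  best≤ v a u p = best-min (options v a) (∈-map⁺ (λ u → value v a u , ident u) (∈-nbrs p))

  open Potential (λ _ → BIG)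

  -- Choosing the parent bounds every entry by the size of the subtree times BIG, so that no entry wraps around.
  best≤pot : ∀ v → v ≢ root → ∀ a → a < depth v → proj₁ (best (options v a)) ≤ pot v
  best≤pot = leaf-induction _ λ v ih v≢r a a<d → begin
    proj₁ (best (options v a))
      ≤⟨ best≤ v a (par v) (par-adj v v≢r) ⟩
    value v a (par v)
      ≤⟨ +-mono-≤ (own≤BIG v a v≢r) (∑child-mono v (entries v ih a)) ⟩
    BIG + ∑child v pot
      ≡⟨ pot-eq v ⟨
    pot v ∎
    where
    open ≤-Reasoning
    own≤BIG : ∀ v a → v ≢ root → own v a (par v) ≤ BIG
    own≤BIG v a v≢r = pick (treeEdge v (par v)) (child (par v) v) (treeEdge⁺ {v} {par v} (inj₁ (v≢r , refl)))
      where
      pick : ∀ t c {x} → t ≡ true → (if t then (if c then 0 else BIG) else x) ≤ BIG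
      pick true true  _ = z≤n
      pick true false _ = ≤-refl
    entries : ∀ v → (∀ c → child c v ≡ true → c ≢ root → ∀ a → a < depth c → proj₁ (best (options c a)) ≤ pot c) →
      ∀ a c → child c v ≡ true → (if ⌊ c Fin.≟ par v ⌋ then C c a else C c (depth v)) ≤ pot c
    entries v ih a c p = known (c Fin.≟ par v)
      where
      d< : depth v < depth c
      d< = ≤-reflexive (sym (child-depth p))
      known : (e : Dec (c ≡ par v)) → (if ⌊ e ⌋ then C c a else C c (depth v)) ≤ pot c
      known (yes refl) = contradiction d< (≤⇒≯ (≤-trans (≤-reflexive (depth-up 1 v)) (m∸n≤m (depth v) 1)))
      -- Reduction never increases a number, so the bound holds for the child's entry before it is
      -- known not to wrap around.
      known (no _)     = ≤-trans (≤-reflexive (C-mod c (depth v) (child≢root p) d<))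
        (≤-trans (m%n≤m _ (base n)) (ih c p (child≢root p) (depth v) d<))

  -- Origin of the 3 in the exponent of `base`: `BIG` has exponent W + 2, and up to n copies of it
  -- are summed.
  C-eq : ∀ v a → v ≢ root → a < depth v → C v a ≡ proj₁ (best (options v a))
  C-eq v a v≢r a<d = trans (C-mod v a v≢r a<d) (m<n⇒m%n≡m (begin-strict
    proj₁ (best (options v a))       ≤⟨ best≤pot v v≢r a a<d ⟩
    pot v                            ≤⟨ pot≤ v ⟩
    ∑ V (λ _ → BIG)                  ≡⟨ ∑-const n BIG ⟩
    n * BIG                          <⟨ *-monoˡ-< BIG {{m^n≢0 (2 + n) (2 + W)}} (m≤n+m (suc n) 1) ⟩
    (2 + n) ^ (3 + W)                ≤⟨ pow≤base (≤-trans (≤-reflexive (+-comm 3 W)) (+-monoˡ-≤ 3 (m≤m+n W K))) ⟩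
    base n                           ∎))
    where open ≤-Reasoning

  C-opt : ∀ v a u → v ≢ root → a < depth v → adj v u ≡ true → C v a ≤ value v a u
  C-opt v a u v≢r a<d p = ≤-trans (≤-reflexive (C-eq v a v≢r a<d)) (best≤ v a u p)

  choiceRound : Fin n → ℕ
  choiceRound v = 4 * H + depth (par v)

  tg : Fin n → ℕ
  tg v = if run (choiceRound v) (par v) CH ≡ᵇ ident v then run (choiceRound v) (par v) TG else depth (par v)

  chosenId : Fin n → ℕ
  chosenId v = if ⌊ v Fin.≟ root ⌋ then ident root else proj₂ (best (options v (tg v)))

  chosenId-root : chosenId root ≡ ident root
  chosenId-root = cong (λ b → if b then ident root else proj₂ (best (options root (tg root)))) (≟-refl root)

  chosenId-nonroot : ∀ {v} → v ≢ root → chosenId v ≡ proj₂ (best (options v (tg v)))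
  chosenId-nonroot {v} v≢r = cong (λ b → if b then ident root else proj₂ (best (options v (tg v)))) (≟-false v≢r)

  4H-late : ∀ {t} v → 4 * H + depth v ≤ t → 2 * H ≤ t
  4H-late v le = ≤-trans (*-monoˡ-≤ H {2} {4} (s≤s (s≤s z≤n))) (≤-trans (m≤m+n (4 * H) (depth v)) le)

  target-eq : ∀ {t} v → v ≢ root → 4 * H + depth v ≤ t → At.target t v ≡ tg v
  target-eq {t} v v≢r le = trans
    (cong₂ (λ τ d → f (4 * τ + pred d) (pred d)) (τ-eq {t} {v} (4H-late v le)) (d-eq {t} {v} (4H-late v le)))
    (trans (cong (λ d → f (4 * H + d) d) (cong pred (depth-par v v≢r)))
      (cong₂ (λ x y → if x ≡ᵇ ident v then y else depth (par v)) (hear-parent v≢r early CH) (hear-parent v≢r early TG)))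
    where
    f : ℕ → ℕ → ℕ
    f s d = if heardBy t v s (At.parentId t v) CH ≡ᵇ ident v then heardBy t v s (At.parentId t v) TG else d
    early : choiceRound v < t
    early = ≤-trans (≤-reflexive (trans (sym (+-suc (4 * H) (depth (par v)))) (cong (4 * H +_) (sym (depth-par v v≢r))))) le

  run-CH-root : ∀ t → run t root CH ≡ ident root
  run-CH-root t = run-small t root CH (if-root t) (ident<base root)

  ident-false : ∀ {u v} → u ≢ v → (ident u ≡ᵇ ident v) ≡ false
  ident-false {u} {v} u≢v = ¬true⇒false λ e → u≢v (ident-inj (≡ᵇ⇒≡ (ident u) (ident v) (true⇒T e)))

  tg-below-root : ∀ v → v ≢ root → par v ≡ root → tg v ≡ depth (par v)
  tg-below-root v v≢r e = cong (λ b → if b then run (choiceRound v) (par v) TG else depth (par v))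
    (trans (cong (_≡ᵇ ident v) (trans (cong (λ u → run (choiceRound v) u CH) e) (run-CH-root (choiceRound v))))
           (ident-false (λ e′ → v≢r (sym e′))))

  tg< : ∀ v → v ≢ root → tg v < depth v
  tg< = root-induction _ (λ r≢r → contradiction refl r≢r) λ v v≢r ih _ → below v v≢r ih (par v Fin.≟ root)
    where
    below : ∀ v → v ≢ root → (par v ≢ root → tg (par v) < depth (par v)) → Dec (par v ≡ root) → tg v < depth v
    below v v≢r ih (yes e) = ≤-trans (s≤s (≤-reflexive (tg-below-root v v≢r e))) (≤-reflexive (sym (depth-par v v≢r)))
    below v v≢r ih (no pv≢r) = ≤-trans (s≤s (split (run (choiceRound v) (par v) CH ≡ᵇ ident v))) (≤-reflexive (sym (depth-par v v≢r)))
      where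
      split : ∀ b → (if b then run (choiceRound v) (par v) TG else depth (par v)) ≤ depth (par v)
      split false = ≤-refl
      -- Again the bound passes through the reduction; only afterwards does it give `run-TG`.
      split true  = ≤-trans (≤-trans (≤-reflexive (run-def (choiceRound v) (par v) TG)) (m%n≤m _ (base n))) (≤-trans (≤-reflexive (target-eq (par v) pv≢r ≤-refl)) (<⇒≤ (ih pv≢r)))

  run-TG : ∀ {t} v → v ≢ root → 4 * H + depth v ≤ t → run t v TG ≡ tg v
  run-TG {t} v v≢r le = run-small t v TG (target-eq v v≢r le)
    (<-trans (tg< v v≢r) (<-≤-trans (depth<n v) (≤-trans (m≤n+m n 2) 2+n≤base)))

  dp-before-choice : ∀ {t} v → 4 * H + depth v ≤ t → 4 * H ∸ depth v ∸ tg v ≤ t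
  dp-before-choice v le = ≤-trans (m∸n≤m _ (tg v)) (≤-trans (m∸n≤m (4 * H) (depth v)) (≤-trans (m≤m+n (4 * H) (depth v)) le))

  choice-eq : ∀ {t} v → 4 * H + depth v ≤ t → At.choice t v ≡ chosenId v
  choice-eq {t} v le = known (v Fin.≟ root)
    where
    known : Dec (v ≡ root) → At.choice t v ≡ chosenId v
    known (yes refl) = trans (if-root t) (sym chosenId-root)
    known (no v≢r)   = trans (if-nonroot t v≢r) (trans
      (cong (proj₂ ∘ best) (trans (cong (At.options t v) (target-eq v v≢r le))
        (Late.options-eq t v (tg v) v≢r (tg< v v≢r) (dp-before-choice v le))))
      (sym (chosenId-nonroot v≢r)))

  -- Turns the announced identifier back into a vertex; there is an option because the parent is a
  -- neighbour.
  best-option : ∀ v a → v ≢ root →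
    ∃ λ u → adj v u ≡ true × best (options v a) ≡ (value v a u , ident u)
  best-option v a v≢r with ∈-map⁻ (λ u → value v a u , ident u) (nonempty (∈-map⁺ (λ u → value v a u , ident u) (∈-nbrs (par-adj v v≢r))))
    where
    nonempty : ∀ {x : ℕ × ℕ} {xs} → x ∈ xs → best xs ∈ xs
    nonempty {xs = y ∷ ys} _ = best-∈ y ys
  ... | u , u∈ , e = u , nbrs-adj u∈ , e

  chosen-neighbour : ∀ v → Dec (v ≡ root) → Σ (Fin n) λ u → chosenId v ≡ ident u × (v ≡ root → u ≡ root) ×
    (v ≢ root → adj v u ≡ true × proj₁ (best (options v (tg v))) ≡ value v (tg v) u)
  chosen-neighbour v (yes refl) = root , chosenId-root , (λ _ → refl) , (λ v≢r → contradiction refl v≢r)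
  chosen-neighbour v (no v≢r)   = let u , p , e = best-option v (tg v) v≢r in
    u , trans (chosenId-nonroot v≢r) (cong proj₂ e) , (λ v≡r → contradiction v≡r v≢r) , (λ _ → p , cong proj₁ e)

  abstract
    ch : Fin n → Fin n
    ch v = proj₁ (chosen-neighbour v (v Fin.≟ root))

    chosenId-ch : ∀ v → chosenId v ≡ ident (ch v)
    chosenId-ch v = proj₁ (proj₂ (chosen-neighbour v (v Fin.≟ root)))

    ch-root : ∀ {v} → v ≡ root → ch v ≡ root
    ch-root {v} = proj₁ (proj₂ (proj₂ (chosen-neighbour v (v Fin.≟ root))))

    ch-best : ∀ v → v ≢ root → adj v (ch v) ≡ true × proj₁ (best (options v (tg v))) ≡ value v (tg v) (ch v)
    ch-best v = proj₂ (proj₂ (proj₂ (chosen-neighbour v (v Fin.≟ root))))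

  run-CH : ∀ {t} v → 4 * H + depth v ≤ t → run t v CH ≡ ident (ch v)
  run-CH {t} v le = run-small t v CH (trans (choice-eq v le) (chosenId-ch v)) (ident<base (ch v))

  tg-eq : ∀ c → c ≢ root → tg c ≡ (if ⌊ c Fin.≟ ch (par c) ⌋ then tg (par c) else depth (par c))
  tg-eq c c≢r = trans (cong (λ b → if b then run (choiceRound c) (par c) TG else depth (par c)) test) (branch (par c Fin.≟ root))
    where
    test : (run (choiceRound c) (par c) CH ≡ᵇ ident c) ≡ ⌊ c Fin.≟ ch (par c) ⌋
    test = trans (cong (_≡ᵇ ident c) (run-CH (par c) ≤-refl)) (trans (ident-≡ᵇ (ch (par c)) c) (≟-comm (ch (par c)) c))
    branch : Dec (par c ≡ root) →
      (if ⌊ c Fin.≟ ch (par c) ⌋ then run (choiceRound c) (par c) TG else depth (par c)) ≡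
      (if ⌊ c Fin.≟ ch (par c) ⌋ then tg (par c) else depth (par c))
    branch (no p≢r) = cong (λ x → if ⌊ c Fin.≟ ch (par c) ⌋ then x else depth (par c)) (run-TG (par c) p≢r ≤-refl)
    branch (yes e) with c Fin.≟ ch (par c)
    ... | yes q = contradiction (trans q (ch-root e)) c≢r
    ... | no _  = refl

  C-ch : ∀ v → v ≢ root → C v (tg v) ≡ value v (tg v) (ch v)
  C-ch v v≢r = trans (C-eq v (tg v) v≢r (tg< v v≢r)) (proj₂ (ch-best v v≢r))

  adj<BIG : directed adj < BIG
  adj<BIG = begin-strict
    directed adj                       ≤⟨ ∑-mono V (λ x → ∑-mono V (λ y → ≤-trans (when-≤ _ _) (weight≤ x y))) ⟩
    ∑ V (λ x → ∑ V (λ y → (2 + n) ^ W)) ≡⟨ trans (∑-cong V (λ _ → ∑-const n _)) (∑-const n _) ⟩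
    n * (n * (2 + n) ^ W)              ≤⟨ *-monoʳ-≤ n (*-monoˡ-≤ ((2 + n) ^ W) (m≤n+m n 2)) ⟩
    n * (2 + n) ^ suc W                <⟨ *-monoˡ-< ((2 + n) ^ suc W) {{m^n≢0 (2 + n) (suc W)}} (m≤n+m (suc n) 1) ⟩
    BIG                                ∎
    where
    open ≤-Reasoning
    weight≤ : ∀ x y → w x y ≤ (2 + n) ^ W
    weight≤ x y = ≤-trans (<⇒≤ (w< x y)) (≤-reflexive (cong (_^ W) (+-comm n 2)))

  open UpperBound C-opt adj<BIG ch tg (ch-root refl)
    (λ v v≢r → proj₁ (ch-best v v≢r)) tg< tg-eq C-ch

  answerList : Fin n → List (ℕ × Bool)
  answerList v = map (λ u → ident u , selected v u) (nbrs v)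

  ans : Fin n → ℕ → Bool
  ans v = answer (answerList v)

  5H≤6H : 5 * H < 6 * H
  5H≤6H = *-monoˡ-< H {{>-nonZero 0<H}} {5} {6} ≤-refl

  choice-done : ∀ v → 4 * H + depth v ≤ 5 * H
  choice-done v = ≤-trans (+-monoʳ-≤ (4 * H) (<⇒≤ (depth<H v))) (≤-reflexive (+-comm (4 * H) H))

  answers-eq : ∀ {t} v → 6 * H ≤ t → At.answers t v ≡ answerList v
  answers-eq {t} v le = edges-map v λ u p → cong (ident u ,_) (cong (not (treeEdge v u) ∧_) (cong₂ _∨_
    (trans (cong (_≡ᵇ ident u) (trans (choice-eq v (≤-trans (choice-done v) (≤-trans (<⇒≤ 5H≤6H) le))) (chosenId-ch v)))
           (ident-≡ᵇ (ch v) u))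
    (trans (cong (_≡ᵇ ident v) (trans (cong (λ τ → heardBy t v (5 * τ) (ident u) CH) (τ-eq late))
              (trans (heard-eq (<-≤-trans 5H≤6H le) p CH) (run-CH u (choice-done u)))))
           (ident-≡ᵇ (ch u) v))))
    where
    late : 2 * H ≤ t
    late = ≤-trans (*-monoˡ-≤ H {2} {6} (s≤s (s≤s z≤n))) le

  answer-neighbour : ∀ (b : Fin n → Bool) {u} xs → u ∈ xs → answer (map (λ u → ident u , b u) xs) (ident u) ≡ b u
  answer-neighbour b {u} (x ∷ xs) p with ident x ≡ᵇ ident u in e
  ... | true = cong b (ident-inj (≡ᵇ⇒≡ (ident x) (ident u) (true⇒T e)))
  ... | false with p
  ... | here refl = ⊥-elim (true≢false (T⇒true (≡⇒≡ᵇ (ident x) (ident x) refl)) e)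
  ... | there q   = answer-neighbour b xs q

  ans-eq : ∀ u v → adj u v ≡ true → ans u (ident v) ≡ selected u v
  ans-eq u v p = answer-neighbour (selected u) (nbrs u) (∈-nbrs p)

  decision-late : ∀ {t} v → 6 * H ≤ t → At.decision t v ≡ just (ans v)
  decision-late {t} v le = trans
    (cong₂ (λ τ xs → if (0 <ᵇ τ) ∧ (6 * τ ≤ᵇ t) then just (answer xs) else nothing)
      (τ-eq (≤-trans (*-monoˡ-≤ H {2} {6} (s≤s (s≤s z≤n))) le)) (answers-eq v le))
    (cong (λ b → if b then just (ans v) else nothing) (∧-true (<ᵇ-true 0<H) (T⇒true (≤⇒≤ᵇ le))))

  decision-early : ∀ {t} v → ¬ 6 * H ≤ t → At.decision t v ≡ nothing
  decision-early {t} v early = trans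
    (cong (λ τ → if (0 <ᵇ τ) ∧ (6 * τ ≤ᵇ t) then just (answer (At.answers t v)) else nothing) (τ-val t v))
    (split (hs root + depth v <ᵇ suc t))
    where
    split : ∀ b → (if (0 <ᵇ when b H) ∧ (6 * when b H ≤ᵇ t) then just (answer (At.answers t v)) else nothing) ≡ nothing
    split false = refl
    split true  = cong (λ b → if b then just (answer (At.answers t v)) else nothing)
      (¬true⇒false (λ e → early (≤ᵇ⇒≤ (6 * H) t (true⇒T (proj₂ (∧-true⁻ {0 <ᵇ H} e))))))

  open Output (λ u v → ans u (ident v)) ans-eq

  solves : SolvesWithin (algorithm program) I ((W + K + 3) * 7) (6 * H)
  solves = (λ t u v _ m → send< t u (ident v) m) , ans ,
    (λ t v → timely t v (6 * H ≤? t)) ,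
    (λ v → trans (output-eq (6 * H) v) (decision-late v ≤-refl)) ,
    (λ u v p → trans (ans-eq u v p) (trans (selected-sym u v) (sym (ans-eq v u (trans (adj-sym v u) p))))) ,
    aug-feasible , aug-2-approx
    where
    timely : ∀ t v → Dec (6 * H ≤ t) →
      (Algorithm.output (algorithm program) (stateAt (algorithm program) I t v) ≡ nothing) ⊎
      (Algorithm.output (algorithm program) (stateAt (algorithm program) I t v) ≡ just (ans v))
    timely t v (yes le) = inj₂ (trans (output-eq t v) (decision-late v le))
    timely t v (no ¬le) = inj₁ (trans (output-eq t v) (decision-early v ¬le))

theorem1 : (W K : ℕ) → Σ Algorithm λ A → Σ ℕ λ B → Σ ℕ λ c →
    ∀ (n : ℕ) (I : Instance n) → WeightsBounded W I → IdentsBounded K I →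
    Σ ℕ λ R → (R Data.Nat.≤ c * suc (height I)) Data.Product.× SolvesWithin A I B R
theorem1 W K =
  Broadcast.algorithm 7 (W + K + 3) (record { emit = Local.emission W ; decide = Local.decision W }) ,
  (W + K + 3) * 7 , 6 ,
  λ n I w< id< → 6 * Analysis.H W K I , *-monoʳ-≤ 6 (Analysis.H≤ W K I) , Correctness.solves W K I w< id<
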